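{- Let $\alpha\in(0,1)$ be a constant. Given a $(\frac1{10},\alpha)$-potent $12$-ary tree code with a constant-size alphabet $S$ (whose size depends on $\alpha$), used to label the StateTree, and an oracle for a decoding procedure of that tree code, the protocol $\mathsf{Sim}_\pi$ is an efficient simulation of any 2-party protocol $\pi$ that has $T$ rounds: it takes $N=O(T)$ rounds and succeeds with probability $1-2^{ -\Omega(T)}$ over the channel errors, assuming that each label is sent using an error-correcting code with label error probability $p<2^{ -42/\alpha}$.
   Context: Protocols. $\pi$ is a 2-party protocol with inputs $x_A,x_B$: in each of $T$ rounds both users simultaneously send each other one bit; user $i\in\{A,B\}$ sends in round $t+1$ the bit $\pi_i(x_i,m_1\cdots m_t)$, where $m_1,\dots,m_t$ are the 2-bit messages (A's bit, B's bit) exchanged so far ($\emptyset$ when $t=0$). $\pi$ is extended beyond round $T$ by letting all users output $0$. The GameTree is the 4-ary tree with arcs labeled $00,01,10,11$ (depth $T$, extended to depth $N$); a node $v$ is identified with the message sequence leading to it, and $\gamma_{\pi,x}$ is the path followed by the noiseless execution of $\pi$ on $x=(x_A,x_B)$. StateTree. The 12-ary tree of depth $N$ in which the children of each node correspond to $\{00,01,10,11,H,B\}\times\{0,1\}$: the first component is a pebble movement on the GameTree (to one of the 4 children; $H$ = stay; $B$ = move back to the parent), the second is the bit output by the user. The arcs of the StateTree are also labeled by symbols of $S$ according to the given tree code: $w(s)$ is the label of the arc between $s$ and its parent, $W(s)$ the concatenation of labels from the root to $s$; $\Delta$ is Hamming distance. Protocol $\mathsf{Sim}_\pi$ (for user $A$;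 user $B$ symmetrically). Begin with own pebble at the root of the GameTree and own state $S_A$ at the child of the StateTree root corresponding to $H\times\pi_A(x_A,\emptyset)$. Repeat $N$ times: (1) send $w(S_A)$ to $B$. (2) Given the sequence $Z$ of labels received so far from $B$, guess $B$'s current state as a node $g$ minimizing $\Delta(W(g),Z)$ (this is the decoding procedure). From $g$ infer the alleged position pebble$(g)$ of $B$'s pebble and the bit $b$ output by $B$ in this round. (3) Let $v$ be the current position of own pebble. (a) If $v=$ pebble$(g)$, move own pebble along the arc $(\pi_A(x_A,v),b)$ to $v'$; the new state is the child of $S_A$ corresponding to $(\pi_A(x_A,v),b)\times\pi_A(x_A,v')$. (b) If $v$ is a strict ancestor of pebble$(g)$, do not move; the new state is the child $H\times\pi_A(x_A,v)$. (c) Otherwise move own pebble to the parent $v'$ of $v$; the new state is the child $B\times\pi_A(x_A,v')$. The simulation succeeds if at its end the least common ancestor of the two pebbles is a node of $\gamma_{\pi,x}$ at depth at least $T$, so both users know the transcript of $\pi$. The channel is memoryless, each label being encoded separately so that it is received incorrectly with probability at most $p$, independently of other labels. "Efficient" means polynomial time given the decoding oracle. Potent tree codes. Two nodes $u,v$ at the same depth $h$ with least common ancestor $w$ at depth $h-\ell$ are $\alpha$-bad if $\Delta(W(u),W(v))<\alpha\ell$; then the paths from $w$ to $u$ and from $w$ to $v$ are $\alpha$-bad paths of length $\ell$. A tree code of depth $N$ is $(\varepsilon,\alpha)$-potent if for every root-to-leaf path $Q$ the union of all $\alpha$-bad subpaths of $Q$ has length less than $\varepsilon N$. -}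

module Defs where

open import Level using (Level) renaming (suc to lsuc; _⊔_ to _⊔ˡ_)
open import Algebra.Bundles using (CommutativeRing)
import Algebra.Definitions.RawMonoid as RawMonoidDefs
open import Data.Bool using (Bool; true; false)
import Data.Bool.Properties as Bool
open import Data.Fin using (Fin; toℕ)
import Data.Fin as Fin
open import Data.Fin.Subset using (Subset; _∈_; ∣_∣)
open import Data.List using (List; []; _∷_; _++_; length; map; foldr; concatMap; allFin)
import Data.List.Properties as List
open import Data.List.Relation.Binary.Suffix.Heterogeneous using (Suffix)
open import Data.List.Relation.Binary.Suffix.Heterogeneous.Properties using (suffix?)
open import Data.Nat as ℕ using (ℕ; zero; suc)
open import Data.Product using (Σ; ∃; ∃-syntax; _×_; _,_; proj₁; proj₂)
import Data.Product.Properties as Product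
open import Data.Sum using (_⊎_)
open import Data.Vec using (Vec; []; _∷_; head; toList; lookup; replicate; _[_]≔_)
import Data.Vec.Properties as Vec
open import Function using (_∘_)
open import Relation.Binary using (DecidableEquality)
open import Relation.Binary.PropositionalEquality using (_≡_; refl; cong)
open import Relation.Nullary using (¬_; Dec; yes; no; does)
open import Relation.Nullary.Decidable using (_×-dec_; ¬?; map′)
open import Relation.Unary using (Pred; Decidable)

-- The real numbers, axiomatised constructively as a Cauchy-complete
-- Archimedean ordered field, together with x ↦ 2 ^ x (characterised as the
-- increasing homomorphism from (ℝ, +) to (ℝ, *) taking 1 to 2).
-- Decidability of the order is not assumed, so that both the classical reals
-- and, say, Bishop's reals are instances.
record Reals (c ℓ₁ ℓ₂ : Level) : Set (lsuc (c ⊔ˡ ℓ₁ ⊔ˡ ℓ₂)) where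
  field
    commutativeRing : CommutativeRing c ℓ₁

  open CommutativeRing commutativeRing public
    using (Carrier; _≈_; _+_; _*_; _-_; -_; 0#; 1#)
  private
    module R = CommutativeRing commutativeRing
    module M = RawMonoidDefs R.+-rawMonoid

  infix 4 _<_ _≤_
  field
    _<_ : Carrier → Carrier → Set ℓ₂

  _≤_ : Carrier → Carrier → Set ℓ₂
  x ≤ y = ¬ (y < x)

  fromℕ : ℕ → Carrier
  fromℕ n = n M.× 1#

  field
    <-irrefl   : ∀ {x} → ¬ (x < x)
    <-trans    : ∀ {x y z} → x < y → y < z → x < z
    <-resp-≈   : ∀ {x x′ y y′} → x ≈ x′ → y ≈ y′ → x < y → x′ < y′
    <-cotrans  : ∀ {x y} → x < y → ∀ z → x < z ⊎ z < y
    ≤-antisym  : ∀ {x y} → x ≤ y → y ≤ x → x ≈ y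
    0<1        : 0# < 1#
    +-monoˡ-<  : ∀ {x y} z → x < y → x + z < y + z
    *-pos      : ∀ {x y} → 0# < x → 0# < y → 0# < x * y
    inverse    : ∀ {x} → 0# < x → ∃[ y ] 0# < y × x * y ≈ 1#
    archimedes : ∀ x → ∃[ n ] x < fromℕ n
    complete   : (x : ℕ → Carrier) →
                 (∀ k m n → k ℕ.≤ m → k ℕ.≤ n →
                   fromℕ (suc k) * (x m - x n) ≤ 1#) →
                 ∃[ l ] ∀ k n → k ℕ.≤ n →
                   fromℕ (suc k) * (x n - l) ≤ 1# ×
                   fromℕ (suc k) * (l - x n) ≤ 1#
    exp₂       : Carrier → Carrier
    exp₂-cong  : ∀ {x y} → x ≈ y → exp₂ x ≈ exp₂ y
    exp₂-+     : ∀ x y → exp₂ (x + y) ≈ exp₂ x * exp₂ y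
    exp₂-1     : exp₂ 1# ≈ fromℕ 2
    exp₂-mono  : ∀ {x y} → x < y → exp₂ x < exp₂ y

  recip : ∀ {x} → 0# < x → Carrier
  recip = proj₁ ∘ inverse

  0<fromℕ : ∀ n → 0# < fromℕ (suc n)
  0<fromℕ zero    = <-resp-≈ R.refl (R.sym (R.+-identityʳ 1#)) 0<1
  0<fromℕ (suc n) = <-trans (0<fromℕ n)
    (<-resp-≈ (R.+-identityˡ _) R.refl (+-monoˡ-< (fromℕ (suc n)) 0<1))

module Probability {c ℓ₁ ℓ₂} (ℛ : Reals c ℓ₁ ℓ₂) where
  open Reals ℛ

  Dist : Set → Set c
  Dist X = List (Carrier × X)

  return : ∀ {X} → X → Dist X
  return x = (1# , x) ∷ []

  _>>=_ : ∀ {X Y} → Dist X → (X → Dist Y) → Dist Y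
  d >>= f = concatMap (λ (p , x) → map (λ (r , y) → (p * r , y)) (f x)) d

  Pr : ∀ {X a} {P : Pred X a} → Decidable P → Dist X → Carrier
  Pr P? []            = 0#
  Pr P? ((p , x) ∷ d) with does (P? x)
  ... | true  = p + Pr P? d
  ... | false = Pr P? d

  -- A memoryless channel on labels: K s r is the probability that r is
  -- received when s is sent.
  Channel : ℕ → Set c
  Channel q = Fin q → Fin q → Carrier

  transmit : ∀ {q} → Channel q → Fin q → Dist (Fin q)
  transmit {q} K s = map (λ r → (K s r , r)) (allFin q)

  record IsChannel {q} (K : Channel q) : Set (ℓ₁ ⊔ˡ ℓ₂) where
    field
      nonneg : ∀ s r → 0# ≤ K s r
      total  : ∀ s → foldr _+_ 0# (map (K s) (allFin q)) ≈ 1#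

  ErrorAtMost : ∀ {q} → Carrier → Channel q → Set ℓ₂
  ErrorAtMost p K = ∀ s → Pr (λ r → ¬? (r Fin.≟ s)) (transmit K s) ≤ p

-- A node at depth t of the tree whose nodes have children indexed by C is
-- the vector of the t choices leading to it, most recent first; so a ∷ s is
-- the child a of s.  Labels along a path are also listed most recent first.
-- Labels are attached to all depths, but a code of depth N is only ever used,
-- and only ever constrained, at depths up to N.

hamming : ∀ {q t} → Vec (Fin q) t → Vec (Fin q) t → ℕ
hamming []      []      = 0
hamming (x ∷ u) (y ∷ v) with x Fin.≟ y
... | yes _ = hamming u v
... | no  _ = suc (hamming u v)

module TreeCodes {C : Set} (_≟_ : DecidableEquality C) where

  -- w s, the label of the arc between s and its parent
  TreeCode : ℕ → Set
  TreeCode q = ∀ {t} → Vec C (suc t) → Fin q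

  W : ∀ {q} → TreeCode q → ∀ {t} → Vec C t → Vec (Fin q) t
  W w []      = []
  W w (a ∷ s) = w (a ∷ s) ∷ W w s

  -- The ℓ for which the least common ancestor of two nodes at depth h is at
  -- depth h - ℓ.
  divergence : ∀ {h} → Vec C h → Vec C h → ℕ
  divergence []      []      = 0
  divergence (a ∷ u) (b ∷ v) with Vec.≡-dec _≟_ (a ∷ u) (b ∷ v)
  ... | yes _ = 0
  ... | no  _ = suc (divergence u v)

  -- u ≼ Q : u is an ancestor of Q, or Q itself
  data _≼_ {h} (u : Vec C h) : ∀ {n} → Vec C n → Set where
    here : u ≼ u
    up   : ∀ {n a} {Q : Vec C n} → u ≼ Q → u ≼ (a ∷ Q)

  IsDecoder : ∀ {q} → ℕ → TreeCode q →
              (∀ {t} → Vec (Fin q) t → Vec C t) → Set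
  IsDecoder {q} N w decode =
    ∀ {t} → t ℕ.≤ N → (Z : Vec (Fin q) t) (g : Vec C t) →
    hamming (W w (decode Z)) Z ℕ.≤ hamming (W w g) Z

  module _ {c ℓ₁ ℓ₂} (ℛ : Reals c ℓ₁ ℓ₂) where
    open Reals ℛ

    Bad : ∀ {q} → Carrier → TreeCode q → ∀ {h} → Vec C h → Vec C h → Set ℓ₂
    Bad α w u v =
      fromℕ (hamming (W w u) (W w v)) < α * fromℕ (divergence u v)

    -- The arc of Q entering depth d lies on an α-bad subpath of Q, i.e. one
    -- from depth h - ℓ to depth h.
    OnBadSubpath : ∀ {q N} → Carrier → TreeCode q → Vec C N → ℕ → Set ℓ₂
    OnBadSubpath α w Q d =
      ∃[ h ] Σ (Vec C h) λ u → Σ (Vec C h) λ v →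
        u ≼ Q × Bad α w u v × h ℕ.< d ℕ.+ divergence u v × d ℕ.≤ h

    -- Membership in the union of the bad subpaths of Q is not decidable when
    -- α is real, so that its length is bounded by bounding all finite sets of
    -- arcs (indexed by 0, …, N - 1 from the root) contained in it.
    Potent : ∀ {q} → ℕ → Carrier → Carrier → TreeCode q → Set ℓ₂
    Potent N ε α w = (Q : Vec C N) (J : Subset N) →
      (∀ {i} → i ∈ J → OnBadSubpath α w Q (suc (toℕ i))) →
      fromℕ ∣ J ∣ < ε * fromℕ N

data Party : Set where
  A B : Party

-- (A's bit , B's bit)
Msg : Set
Msg = Bool × Bool

-- A node is the sequence of messages leading to it, most recent first: m ∷ v
-- is the child of v along the arc m.
Node : Set
Node = List Msg

-- Only the values at transcripts shorter than the number of rounds matter.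
record Protocol : Set₁ where
  field
    Input : Party → Set
    bit   : ∀ i → Input i → Node → Bool

-- The bits of a T-round protocol, extended by 0.
nextBit : ℕ → (π : Protocol) → (∀ i → Protocol.Input π i) → Party → Node → Bool
nextBit T π x i v with length v ℕ.<? T
... | yes _ = Protocol.bit π i (x i) v
... | no  _ = false

-- The node of γ at the given depth.
noiseless : (Party → Node → Bool) → ℕ → Node
noiseless next zero    = []
noiseless next (suc t) = (next A v , next B v) ∷ v
  where v = noiseless next t

_≟ᴹ_ : DecidableEquality Msg
_≟ᴹ_ = Product.≡-dec Bool._≟_ Bool._≟_

_≟ᴺ_ : DecidableEquality Node
_≟ᴺ_ = List.≡-dec _≟ᴹ_

parent : Node → Node
parent []      = []
parent (_ ∷ v) = v

-- u ⊑ v : u is an ancestor of v, or v itself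
_⊑_ : Node → Node → Set
_⊑_ = Suffix _≡_

_⊑?_ : ∀ u v → Dec (u ⊑ v)
_⊑?_ = suffix? _≟ᴹ_

lca : Node → Node → Node
lca []      v = []
lca (m ∷ u) v with (m ∷ u) ⊑? v
... | yes _ = m ∷ u
... | no  _ = lca u v

data Move : Set where
  to : Msg → Move
  H  : Move
  B  : Move

_≟ᵐ_ : DecidableEquality Move
to m ≟ᵐ to n = map′ (cong to) (λ { refl → refl }) (m ≟ᴹ n)
to _ ≟ᵐ H    = no λ ()
to _ ≟ᵐ B    = no λ ()
H    ≟ᵐ to _ = no λ ()
H    ≟ᵐ H    = yes refl
H    ≟ᵐ B    = no λ ()
B    ≟ᵐ to _ = no λ ()
B    ≟ᵐ H    = no λ ()
B    ≟ᵐ B    = yes refl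

Arc : Set
Arc = Move × Bool

_≟ᴬ_ : DecidableEquality Arc
_≟ᴬ_ = Product.≡-dec _≟ᵐ_ Bool._≟_

open TreeCodes _≟ᴬ_ public

-- A decoded state may prescribe moving back from the root; the pebble then
-- stays at the root.
move : Move → Node → Node
move (to m) v = m ∷ v
move H      v = v
move B      v = parent v

pebble : ∀ {t} → Vec Arc t → Node
pebble []            = []
pebble ((m , _) ∷ s) = move m (pebble s)

module Sim {q} (w : TreeCode q) (decode : ∀ {t} → Vec (Fin q) t → Vec Arc t)
           (next : Party → Node → Bool) where

  -- The state lies one level deeper than the number t of completed rounds,
  -- since a user already starts at a child of the root.
  record Local (t : ℕ) : Set where
    constructor ⟨_,_,_⟩
    field
      position : Node
      state    : Vec Arc (suc t)
      received : Vec (Fin q) t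

  open Local public

  start : Party → Local 0
  start i = ⟨ [] , (H , next i []) ∷ [] , [] ⟩

  outgoing : ∀ {t} → Local t → Fin q
  outgoing L = w (state L)

  message : Party → (own other : Bool) → Msg
  message A own other = own , other
  message B own other = other , own

  update : ∀ {t} → Party → Local t → Fin q → Local (suc t)
  update {t} i ⟨ v , s , Z ⟩ z = go (v ≟ᴺ pebble g) (v ⊑? pebble g)
    where
    g : Vec Arc (suc t)
    g = decode (z ∷ Z)

    b : Bool
    b = proj₂ (head g)

    advance : Move → Local (suc t)
    advance m = ⟨ v′ , (m , next i v′) ∷ s , z ∷ Z ⟩
      where v′ = move m v

    go : Dec (v ≡ pebble g) → Dec (v ⊑ pebble g) → Local (suc t)
    go (yes _) _       = advance (to (message i (next i v) b))
    go (no _)  (yes _) = advance H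
    go (no _)  (no _)  = advance B

  -- The behaviour of one user as a function of the labels received (most
  -- recent first)
  local : Party → ∀ {t} → Vec (Fin q) t → Local t
  local i []      = start i
  local i (z ∷ Z) = update i (local i Z) z

  Config : ℕ → Set
  Config t = Local t × Local t

  Success : ℕ → ∀ {t} → Config t → Set
  Success T (LA , LB) = T ℕ.≤ length v × v ≡ noiseless next (length v)
    where v = lca (position LA) (position LB)

  success? : ∀ T {t} → Decidable (Success T {t})
  success? T (LA , LB) = (T ℕ.≤? length v) ×-dec (v ≟ᴺ noiseless next (length v))
    where v = lca (position LA) (position LB)

  module _ {c ℓ₁ ℓ₂} (ℛ : Reals c ℓ₁ ℓ₂) where
    open Probability ℛ

    -- K i carries the labels sent by i.
    run : (Party → Channel q) → ∀ t → Dist (Config t)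
    run K zero    = return (start A , start B)
    run K (suc t) =
      run K t                        >>= λ (LA , LB) →
      transmit (K A) (outgoing LA)   >>= λ a →
      transmit (K B) (outgoing LB)   >>= λ b →
      return (update A LA b , update B LB a)

-- The model is the WHILE language of Jones (Computability and Complexity from
-- a Programming Perspective), in which the polynomial-time computable
-- functions are the usual ones, extended with oracle calls and with the
-- exchange of data.

data Tree : Set where
  nil : Tree
  _∙_ : Tree → Tree → Tree

infixr 5 _∙_

size : Tree → ℕ
size nil     = 1
size (a ∙ b) = suc (size a ℕ.+ size b)

data Expr (k : ℕ) : Set where
  var   : Fin k → Expr k
  nil   : Expr k
  cons  : Expr k → Expr k → Expr k
  hd tl : Expr k → Expr k

data Cmd (O : Set) (k : ℕ) : Set where
  skip           : Cmd O k
  _:=_           : Fin k → Expr k → Cmd O k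
  _⨟_            : Cmd O k → Cmd O k → Cmd O k
  if_then_else_  : Expr k → Cmd O k → Cmd O k → Cmd O k
  while_loop_    : Expr k → Cmd O k → Cmd O k
  _:=query_[_]   : Fin k → O → Expr k → Cmd O k
  send           : Expr k → Cmd O k
  receive        : Fin k → Cmd O k

infixr 3 _⨟_
infix  4 _:=_ _:=query_[_]

data Event : Set where
  sent got : Tree → Event

Store : ℕ → Set
Store k = Vec Tree k

eval : ∀ {k} → Store k → Expr k → Tree
eval σ (var x)    = lookup σ x
eval σ nil        = nil
eval σ (cons e f) = eval σ e ∙ eval σ f
eval σ (hd e) with eval σ e
... | nil   = nil
... | a ∙ _ = a
eval σ (tl e) with eval σ e
... | nil   = nil
... | _ ∙ b = b

-- Exec c σ es n σ′ : c takes the store σ to σ′ in n steps, with the external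
-- events es.  Evaluating an expression of the (fixed) program counts as one
-- step; oracle calls and communication are charged for the size of the data
-- exchanged, as trees may be exponentially larger than the number of steps
-- taken to build them.
module Semantics {O : Set} (Answer : O → Tree → Tree → Set) {k : ℕ} where

  data Exec : Cmd O k → Store k → List Event → ℕ → Store k → Set where

    skip : ∀ {σ} → Exec skip σ [] 1 σ

    assign : ∀ {σ x e} → Exec (x := e) σ [] 1 (σ [ x ]≔ eval σ e)

    seq : ∀ {σ σ′ σ″ c c′ es es′ m n} →
      Exec c σ es m σ′ → Exec c′ σ′ es′ n σ″ →
      Exec (c ⨟ c′) σ (es ++ es′) (m ℕ.+ n) σ″

    if-true : ∀ {σ σ′ e c c′ es n a b} → eval σ e ≡ a ∙ b →
      Exec c σ es n σ′ → Exec (if e then c else c′) σ es (suc n) σ′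

    if-false : ∀ {σ σ′ e c c′ es n} → eval σ e ≡ nil →
      Exec c′ σ es n σ′ → Exec (if e then c else c′) σ es (suc n) σ′

    while-true : ∀ {σ σ′ σ″ e c es es′ m n a b} → eval σ e ≡ a ∙ b →
      Exec c σ es m σ′ → Exec (while e loop c) σ′ es′ n σ″ →
      Exec (while e loop c) σ (es ++ es′) (suc (m ℕ.+ n)) σ″

    while-false : ∀ {σ e c} → eval σ e ≡ nil →
      Exec (while e loop c) σ [] 1 σ

    query : ∀ {σ x o e d} → Answer o (eval σ e) d →
      Exec (x :=query o [ e ]) σ []
           (suc (size (eval σ e) ℕ.+ size d)) (σ [ x ]≔ d)

    send : ∀ {σ e} →
      Exec (send e) σ (sent (eval σ e) ∷ []) (suc (size (eval σ e))) σ

    receive : ∀ {σ x} d →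
      Exec (receive x) σ (got d ∷ []) (suc (size d)) (σ [ x ]≔ d)

encℕ : ℕ → Tree
encℕ zero    = nil
encℕ (suc n) = nil ∙ encℕ n

encBool : Bool → Tree
encBool false = nil
encBool true  = nil ∙ nil

encMsg : Msg → Tree
encMsg (a , b) = encBool a ∙ encBool b

encMove : Move → Tree
encMove H      = nil
encMove B      = nil ∙ nil
encMove (to m) = (nil ∙ nil) ∙ encMsg m

encArc : Arc → Tree
encArc (m , b) = encMove m ∙ encBool b

encList : ∀ {X : Set} → (X → Tree) → List X → Tree
encList enc []       = nil
encList enc (x ∷ xs) = enc x ∙ encList enc xs

encLabel : ∀ {q} → Fin q → Tree
encLabel = encℕ ∘ toℕ

encNode : Node → Tree
encNode = encList encMsg

encState : ∀ {t} → Vec Arc t → Tree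
encState = encList encArc ∘ toList

encLabels : ∀ {q t} → Vec (Fin q) t → Tree
encLabels = encList encLabel ∘ toList

data Oracle : Set where
  protocol label decoding : Oracle

-- Variable zero holds the input initially and the output finally.
record Program : Set where
  field
    extra : ℕ
    body  : Cmd Oracle (suc extra)

module Implementation (N : ℕ) {q} (w : TreeCode q)
    (decode : ∀ {t} → Vec (Fin q) t → Vec Arc t)
    (next : Party → Node → Bool) where

  open Sim w decode next

  data Answer (i : Party) : Oracle → Tree → Tree → Set where
    protocol : ∀ v → Answer i protocol (encNode v) (encBool (next i v))
    label    : ∀ {t} → suc t ℕ.≤ N → (s : Vec Arc (suc t)) →
               Answer i label (encState s) (encLabel (w s))
    decoding : ∀ {t} → t ℕ.≤ N → (Z : Vec (Fin q) t) →
               Answer i decoding (encLabels Z) (encState (decode Z))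

  -- The communication of user i when receiving the labels Z.
  trace : Party → ∀ {t} → Vec (Fin q) t → List Event
  trace i []      = []
  trace i (z ∷ Z) = trace i Z ++
    sent (encLabel (outgoing (local i Z))) ∷ got (encLabel z) ∷ []

  -- Given N, the program plays the part of user i in N rounds of the
  -- simulation, whatever labels it receives, within the given number of
  -- steps, and outputs the final position of its pebble.
  Implements : Program → Party → ℕ → Set
  Implements P i bound = (Z : Vec (Fin q) N) →
    ∃[ n ] Σ (Store (suc extra)) λ σ →
      Exec body (encℕ N ∷ replicate extra nil) (trace i Z) n σ ×
      n ℕ.≤ bound ×
      head σ ≡ encNode (position (local i Z))
    where
    open Program P
    open Semantics (Answer i)

{-# OPTIONS --safe #-}
module Submission where

-- Call a round bad if one of the users decodes the other's state wrongly.  The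
-- mark of the pebbles (the depth of their least common ancestor minus the
-- larger distance to it) grows by 1 in a round that is not bad and drops by at
-- most 3 in a bad one, and the least common ancestor always lies on the
-- noiseless path; so with N = 10T rounds a failure needs at least 9T/4 bad
-- rounds.  For each user, fewer than N/10 = T of these can be due to bad
-- subpaths of the StateTree.  The others end intervals in which the density of
-- channel errors is at least α/2, and a rising sun argument shows that e errors
-- account for at most 2e/α of them.  Hence a failure needs at least αT/8
-- errors, whose probability is bounded by Chernoff's method: the mean of z ^ e
-- is at most (1 + z p) ^ 2N, where z = 2 ^ (16/α).

open import Defs
open import Algebra.Bundles using (CommutativeRing)
import Algebra.Properties.Semiring.Exp
import Algebra.Properties.Semiring.Mult
import Algebra.Solver.Ring.NaturalCoefficients.Default
open import Data.Bool using (Bool; true; false; _xor_)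
open import Data.Empty using (⊥)
open import Data.Fin as Fin using (Fin; toℕ)
open import Data.Fin.Patterns
import Data.Fin.Properties as Fin
open import Data.Fin.Subset using (Subset; _∈_; ∣_∣)
open import Data.List using (List; []; _∷_; _++_; _ʳ++_; length; map; foldr; reverse; allFin)
import Data.List.Properties as List
open import Data.List.Relation.Binary.Pointwise using (Pointwise-≡⇒≡; ≡⇒Pointwise-≡)
import Data.List.Relation.Binary.Suffix.Heterogeneous as Suffix
import Data.List.Relation.Binary.Suffix.Heterogeneous.Properties as Suffix
open import Data.List.Relation.Unary.All using (All; []; _∷_; universal)
import Data.List.Relation.Unary.All.Properties as All
open import Data.Nat as ℕ using (ℕ; zero; suc; z≤n; s≤s)
import Data.Nat.Properties as ℕ
open import Data.Nat.Tactic.RingSolver using (solve-∀)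
open import Data.Product using (Σ; ∃-syntax; _×_; _,_; proj₁; proj₂)
open import Data.Sum using (_⊎_; inj₁; inj₂)
open import Data.Vec using (Vec; []; _∷_; _∷ʳ_; here; there; head; tail; toList; lookup; replicate; _[_]≔_)
import Data.Vec.Properties as Vec
open import Function using (_∘_; case_of_)
open import Relation.Binary using (DecidableEquality; IsPreorder; _Respects₂_)
import Relation.Binary.Reasoning.Base.Triple
open import Relation.Binary.PropositionalEquality as ≡ using (_≡_; _≢_; cong; cong₂; subst)
open import Relation.Nullary using (¬_; Dec; yes; no; does; contradiction)
open import Relation.Nullary.Decidable using (¬?; ¬¬-excluded-middle)
open import Relation.Unary using (Pred; Decidable)

-- Real numbers

-- The factor 10 is a budget. With N = cT, a failure gives cT < T + 4k, where k counts the wrong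
-- decodings of both users. Fewer than 2cT/10 of these are due to bad subpaths and at most 2e/α to
-- errors, so 8e > α(c/5 - 1)T. This is useful once c > 5, and c = 10 leaves αT. The base z turns
-- αT/8 errors into the weight 4 ^ T, while the bound on p keeps the mean weight of the 20T
-- transmissions below 2 ^ T. A label depends on everything received before it, so the errors are
-- not handled as a fixed family of independent variables. Conditioned on the configuration, each
-- round multiplies the mean weight by at most (1 + z p) ^ 2, whatever is being sent. The order of
-- the reals is not decidable, and hence neither is badness. But every real bound derived from
-- badness is a `_≤_`, the negation of a strict inequality, so it may be proved under a double
-- negation, where excluded middle is available.

module RealProperties {c ℓ₁ ℓ₂} (ℛ : Reals c ℓ₁ ℓ₂) where
  open Reals ℛ
  open CommutativeRing commutativeRing public
    using (refl; sym; trans; +-cong; +-congˡ; +-congʳ; *-cong; *-congˡ; *-congʳ; *-comm; *-assoc; +-comm;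
           +-assoc; +-identityˡ; +-identityʳ; *-identityˡ; *-identityʳ; zeroˡ; zeroʳ; distribˡ; distribʳ;
           -‿inverseˡ; -‿inverseʳ; semiring; commutativeSemiring; isEquivalence)
  open Algebra.Properties.Semiring.Mult semiring using (×-homo-+; ×1-homo-*)
  open Algebra.Properties.Semiring.Exp semiring public using (_^_; ^-homo-*; ^-assocʳ; ^-congˡ)
  open Algebra.Solver.Ring.NaturalCoefficients.Default commutativeSemiring public
    using (solve; _:+_; _:*_; con) renaming (_:=_ to _⊜_)

  <-asym : ∀ {x y} → x < y → ¬ (y < x)
  <-asym x<y y<x = <-irrefl (<-trans x<y y<x)

  <⇒≤ : ∀ {x y} → x < y → x ≤ y
  <⇒≤ = <-asym

  <-≤-trans : ∀ {x y z} → x < y → y ≤ z → x < z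
  <-≤-trans {z = z} x<y y≤z with <-cotrans x<y z
  ... | inj₁ x<z = x<z
  ... | inj₂ z<y = contradiction z<y y≤z

  ≤-<-trans : ∀ {x y z} → x ≤ y → y < z → x < z
  ≤-<-trans {x = x} x≤y y<z with <-cotrans y<z x
  ... | inj₁ y<x = contradiction y<x x≤y
  ... | inj₂ x<z = x<z

  ≤-trans : ∀ {x y z} → x ≤ y → y ≤ z → x ≤ z
  ≤-trans x≤y y≤z z<x = x≤y (≤-<-trans y≤z z<x)

  ≤-reflexive : ∀ {x y} → x ≈ y → x ≤ y
  ≤-reflexive x≈y y<x = <-irrefl (<-resp-≈ refl x≈y y<x)

  ≤-refl : ∀ {x} → x ≤ x
  ≤-refl = <-irrefl

  ≤-isPreorder : IsPreorder _≈_ _≤_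
  ≤-isPreorder = record { isEquivalence = isEquivalence ; reflexive = ≤-reflexive ; trans = ≤-trans }

  <-respects-≈ : _<_ Respects₂ _≈_
  <-respects-≈ = (λ y≈z → <-resp-≈ refl y≈z) , (λ y≈z → <-resp-≈ y≈z refl)

  module ≤-Reasoning = Relation.Binary.Reasoning.Base.Triple
    {_≈_ = _≈_} {_≤_ = _≤_} {_<_ = _<_}
    ≤-isPreorder <-asym <-trans <-respects-≈ <⇒≤ <-≤-trans ≤-<-trans

  -- The case split that the undecidable order does not give outright. It suffices for goals of the
  -- form `_≤_`, which are negations.
  ≤⇒¬¬<⊎≈ : ∀ {x y} → x ≤ y → ¬ ¬ (x < y ⊎ x ≈ y)
  ≤⇒¬¬<⊎≈ x≤y k = k (inj₂ (≤-antisym x≤y (k ∘ inj₁)))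

  +-cancelʳ-< : ∀ {x y} z → x + z < y + z → x < y
  +-cancelʳ-< z lt = <-resp-≈ (cancel _) (cancel _) (+-monoˡ-< (- z) lt)
    where
    cancel : ∀ x → x + z + - z ≈ x
    cancel x = trans (+-assoc x z (- z)) (trans (+-congˡ (-‿inverseʳ z)) (+-identityʳ x))

  +-monoˡ-≤ : ∀ {x y} z → x ≤ y → x + z ≤ y + z
  +-monoˡ-≤ z x≤y = x≤y ∘ +-cancelʳ-< z

  +-mono-≤ : ∀ {x y u v} → x ≤ y → u ≤ v → x + u ≤ y + v
  +-mono-≤ {x} {y} {u} {v} x≤y u≤v = ≤-trans (+-monoˡ-≤ u x≤y)
    (≤-trans (≤-reflexive (+-comm y u)) (≤-trans (+-monoˡ-≤ y u≤v) (≤-reflexive (+-comm v y))))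

  +-cancelʳ-≤ : ∀ {x y} z → x + z ≤ y + z → x ≤ y
  +-cancelʳ-≤ z le = le ∘ +-monoˡ-< z

  <0⇒0<- : ∀ {x} → x < 0# → 0# < - x
  <0⇒0<- {x} x<0 = <-resp-≈ (-‿inverseʳ x) (+-identityˡ (- x)) (+-monoˡ-< (- x) x<0)

  *-monoʳ-< : ∀ {x y z} → 0# < z → x < y → z * x < z * y
  *-monoʳ-< {x} {y} {z} 0<z x<y = +-cancelʳ-< (z * - x)
    (<-resp-≈ (sym (trans (sym (distribˡ z x (- x))) (trans (*-congˡ (-‿inverseʳ x)) (zeroʳ z))))
              (distribˡ z y (- x))
              (*-pos 0<z (<-resp-≈ (-‿inverseʳ x) refl (+-monoˡ-< (- x) x<y))))

  *-monoʳ-≤ : ∀ {x y z} → 0# ≤ z → x ≤ y → z * x ≤ z * y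
  *-monoʳ-≤ {x} {y} {z} 0≤z x≤y zy<zx = ≤⇒¬¬<⊎≈ 0≤z λ where
    (inj₂ 0≈z) → <-irrefl (<-resp-≈ (trans (*-congʳ (sym 0≈z)) (zeroˡ y)) (trans (*-congʳ (sym 0≈z)) (zeroˡ x)) zy<zx)
    (inj₁ 0<z) → ≤⇒¬¬<⊎≈ x≤y λ where
      (inj₁ x<y) → <-asym zy<zx (*-monoʳ-< 0<z x<y)
      (inj₂ x≈y) → ≤-reflexive (*-congˡ x≈y) zy<zx

  *-monoˡ-≤ : ∀ {x y z} → 0# ≤ z → x ≤ y → x * z ≤ y * z
  *-monoˡ-≤ 0≤z x≤y = ≤-trans (≤-reflexive (*-comm _ _)) (≤-trans (*-monoʳ-≤ 0≤z x≤y) (≤-reflexive (*-comm _ _)))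

  *-mono-≤ : ∀ {x y u v} → 0# ≤ x → 0# ≤ v → x ≤ y → u ≤ v → x * u ≤ y * v
  *-mono-≤ 0≤x 0≤v x≤y u≤v = ≤-trans (*-monoʳ-≤ 0≤x u≤v) (*-monoˡ-≤ 0≤v x≤y)

  *-nonneg : ∀ {x y} → 0# ≤ x → 0# ≤ y → 0# ≤ x * y
  *-nonneg {x} 0≤x 0≤y = ≤-trans (≤-reflexive (sym (zeroʳ x))) (*-monoʳ-≤ 0≤x 0≤y)

  +-nonneg : ∀ {x y} → 0# ≤ x → 0# ≤ y → 0# ≤ x + y
  +-nonneg 0≤x 0≤y = ≤-trans (≤-reflexive (sym (+-identityˡ 0#))) (+-mono-≤ 0≤x 0≤y)

  x≤x+y : ∀ {x y} → 0# ≤ y → x ≤ x + y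
  x≤x+y {x} 0≤y = ≤-trans (≤-reflexive (sym (+-identityʳ x))) (+-mono-≤ ≤-refl 0≤y)

  y≤x+y : ∀ {x y} → 0# ≤ x → y ≤ x + y
  y≤x+y 0≤x = ≤-trans (x≤x+y 0≤x) (≤-reflexive (+-comm _ _))

  x-y≤z : ∀ {x y z} → x ≤ z + y → x - y ≤ z
  x-y≤z {x} {y} {z} le = +-cancelʳ-≤ y (begin
    x - y + y      ≈⟨ +-assoc x (- y) y ⟩
    x + (- y + y)  ≈⟨ +-congˡ (-‿inverseˡ y) ⟩
    x + 0#         ≈⟨ +-identityʳ x ⟩
    x              ≤⟨ le ⟩
    z + y          ∎)
    where open ≤-Reasoning

  0≤1 : 0# ≤ 1#
  0≤1 = <⇒≤ 0<1

  fromℕ-+ : ∀ m n → fromℕ (m ℕ.+ n) ≈ fromℕ m + fromℕ n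
  fromℕ-+ = ×-homo-+ 1#

  fromℕ-* : ∀ m n → fromℕ (m ℕ.* n) ≈ fromℕ m * fromℕ n
  fromℕ-* = ×1-homo-*

  0≤fromℕ : ∀ n → 0# ≤ fromℕ n
  0≤fromℕ zero    = ≤-refl
  0≤fromℕ (suc n) = <⇒≤ (0<fromℕ n)

  fromℕ-mono-≤ : ∀ {m n} → m ℕ.≤ n → fromℕ m ≤ fromℕ n
  fromℕ-mono-≤ {n = n} z≤n = 0≤fromℕ n
  fromℕ-mono-≤ (s≤s m≤n) = +-mono-≤ ≤-refl (fromℕ-mono-≤ m≤n)

  fromℕ-1 : fromℕ 1 ≈ 1#
  fromℕ-1 = +-identityʳ 1#

  fromℕ-^ : ∀ m n → fromℕ (m ℕ.^ n) ≈ fromℕ m ^ n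
  fromℕ-^ m zero    = fromℕ-1
  fromℕ-^ m (suc n) = trans (fromℕ-* m (m ℕ.^ n)) (*-congˡ (fromℕ-^ m n))

  ^-nonneg : ∀ {x} n → 0# ≤ x → 0# ≤ x ^ n
  ^-nonneg zero    0≤x = 0≤1
  ^-nonneg (suc n) 0≤x = *-nonneg 0≤x (^-nonneg n 0≤x)

  ^-monoˡ-≤ : ∀ {x y} n → 0# ≤ x → x ≤ y → x ^ n ≤ y ^ n
  ^-monoˡ-≤ zero    0≤x x≤y = ≤-refl
  ^-monoˡ-≤ (suc n) 0≤x x≤y =
    *-mono-≤ 0≤x (^-nonneg n (≤-trans 0≤x x≤y)) x≤y (^-monoˡ-≤ n 0≤x x≤y)

  exp₂-mono-≤ : ∀ {x y} → x ≤ y → exp₂ x ≤ exp₂ y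
  exp₂-mono-≤ x≤y lt = ≤⇒¬¬<⊎≈ x≤y λ where
    (inj₁ x<y) → <-asym lt (exp₂-mono x<y)
    (inj₂ x≈y) → ≤-reflexive (exp₂-cong x≈y) lt

  0<2 : 0# < fromℕ 2
  0<2 = 0<fromℕ 1

  -- The factor `exp₂ 0#` leaves `exp₂ 1#` unchanged, and that is the invertible number 2.
  exp₂-0 : exp₂ 0# ≈ 1#
  exp₂-0 = begin-equality
    exp₂ 0#                     ≈⟨ *-identityʳ (exp₂ 0#) ⟨
    exp₂ 0# * 1#                ≈⟨ *-congˡ inv ⟨
    exp₂ 0# * (fromℕ 2 * ½)     ≈⟨ *-assoc _ _ _ ⟨
    exp₂ 0# * fromℕ 2 * ½       ≈⟨ *-congʳ (*-congˡ exp₂-1) ⟨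
    exp₂ 0# * exp₂ 1# * ½       ≈⟨ *-congʳ (exp₂-+ 0# 1#) ⟨
    exp₂ (0# + 1#) * ½          ≈⟨ *-congʳ (exp₂-cong (+-identityˡ 1#)) ⟩
    exp₂ 1# * ½                 ≈⟨ *-congʳ exp₂-1 ⟩
    fromℕ 2 * ½                 ≈⟨ inv ⟩
    1#                          ∎
    where
    open ≤-Reasoning
    ½ = recip 0<2
    inv : fromℕ 2 * ½ ≈ 1#
    inv = proj₂ (proj₂ (inverse 0<2))

  exp₂-inverseʳ : ∀ x → exp₂ x * exp₂ (- x) ≈ 1#
  exp₂-inverseʳ x = trans (sym (exp₂-+ x (- x))) (trans (exp₂-cong (-‿inverseʳ x)) exp₂-0)

  -- Monotonicity compares with `exp₂ 0#`, which is 1, when x is not negative. For negative x,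
  -- `exp₂ (- x)` exceeds 1, and its product with a negative `exp₂ x` could not be 1.
  exp₂-nonneg : ∀ x → 0# ≤ exp₂ x
  exp₂-nonneg x e<0 = ¬¬-excluded-middle λ where
    (no x≮0)  → ≤-trans 0≤1 (≤-trans (≤-reflexive (sym exp₂-0)) (exp₂-mono-≤ x≮0)) e<0
    (yes x<0) → <-asym 0<1 (<-resp-≈ (trans (*-comm _ _) (exp₂-inverseʳ x)) (zeroʳ _)
      (*-monoʳ-< (≤-<-trans 0≤1 (<-resp-≈ exp₂-0 refl (exp₂-mono (<0⇒0<- x<0)))) e<0))

  exp₂-^ : ∀ x n → exp₂ (fromℕ n * x) ≈ exp₂ x ^ n
  exp₂-^ x zero    = trans (exp₂-cong (zeroˡ x)) exp₂-0
  exp₂-^ x (suc n) = begin-equality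
    exp₂ ((1# + fromℕ n) * x)       ≈⟨ exp₂-cong (trans (distribʳ x 1# (fromℕ n)) (+-congʳ (*-identityˡ x))) ⟩
    exp₂ (x + fromℕ n * x)          ≈⟨ exp₂-+ x _ ⟩
    exp₂ x * exp₂ (fromℕ n * x)     ≈⟨ *-congˡ (exp₂-^ x n) ⟩
    exp₂ x * exp₂ x ^ n             ∎
    where open ≤-Reasoning

  exp₂-fromℕ : ∀ n → exp₂ (fromℕ n) ≈ fromℕ 2 ^ n
  exp₂-fromℕ n = begin-equality
    exp₂ (fromℕ n)       ≈⟨ exp₂-cong (*-identityʳ _) ⟨
    exp₂ (fromℕ n * 1#)  ≈⟨ exp₂-^ 1# n ⟩
    exp₂ 1# ^ n          ≈⟨ ^-congˡ n exp₂-1 ⟩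
    fromℕ 2 ^ n          ∎
    where open ≤-Reasoning

  -- A converse of Bernoulli's inequality, (1 + x) ^ n * (1 - n x) ≤ 1.
  [1+x]^n≤1+nx[1+x]^n : ∀ {x} n → 0# ≤ x →
    (1# + x) ^ n ≤ 1# + fromℕ n * x * (1# + x) ^ n
  [1+x]^n≤1+nx[1+x]^n {x} zero    0≤x =
    ≤-reflexive (solve 1 (λ x → con 1 ⊜ con 1 :+ con 0 :* x :* con 1) refl x)
  [1+x]^n≤1+nx[1+x]^n {x} (suc n) 0≤x = begin
    (1# + x) * P                           ≈⟨ solve 2 (λ x P → (con 1 :+ x) :* P ⊜ P :+ x :* P) refl x P ⟩
    P + x * P                              ≤⟨ +-monoˡ-≤ _ ([1+x]^n≤1+nx[1+x]^n n 0≤x) ⟩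
    1# + fromℕ n * x * P + x * P           ≈⟨ solve 3 (λ m x P → con 1 :+ m :* x :* P :+ x :* P ⊜ con 1 :+ (con 1 :+ m) :* x :* P) refl (fromℕ n) x P ⟩
    1# + (1# + fromℕ n) * x * P            ≤⟨ +-mono-≤ ≤-refl (*-monoʳ-≤ (*-nonneg (0≤fromℕ (suc n)) 0≤x) P≤) ⟩
    1# + (1# + fromℕ n) * x * ((1# + x) * P)  ∎
    where
    open ≤-Reasoning
    P = (1# + x) ^ n
    P≤ : P ≤ (1# + x) * P
    P≤ = ≤-trans (x≤x+y (*-nonneg 0≤x (^-nonneg n (+-nonneg 0≤1 0≤x))))
           (≤-reflexive (solve 2 (λ x P → P :+ x :* P ⊜ (con 1 :+ x) :* P) refl x P))

  -- With P the power, twice the preceding bound reads 2P ≤ 2 + (2nx)P ≤ 2 + P, and one P cancels.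
  [1+x]^n≤2 : ∀ {x} n → 0# ≤ x → fromℕ 2 * (fromℕ n * x) ≤ 1# → (1# + x) ^ n ≤ fromℕ 2
  [1+x]^n≤2 {x} n 0≤x small = +-cancelʳ-≤ P (begin
    P + P                              ≤⟨ +-mono-≤ step step ⟩
    1# + nx * P + (1# + nx * P)        ≈⟨ solve 2 (λ a P → con 1 :+ a :* P :+ (con 1 :+ a :* P) ⊜ (con 1 :+ (con 1 :+ con 0)) :+ (con 1 :+ (con 1 :+ con 0)) :* a :* P) refl nx P ⟩
    fromℕ 2 + fromℕ 2 * nx * P         ≈⟨ +-congˡ (*-comm _ P) ⟩
    fromℕ 2 + P * (fromℕ 2 * nx)       ≤⟨ +-mono-≤ ≤-refl (*-monoʳ-≤ (^-nonneg n (+-nonneg 0≤1 0≤x)) small) ⟩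
    fromℕ 2 + P * 1#                   ≈⟨ +-congˡ (*-identityʳ P) ⟩
    fromℕ 2 + P                        ∎)
    where
    open ≤-Reasoning
    nx = fromℕ n * x
    P = (1# + x) ^ n
    step = [1+x]^n≤1+nx[1+x]^n n 0≤x

  -- For z = 2 ^ (16 / α), the weight z ^ e of an execution with e errors is at
  -- least 4 ^ T when α T ≤ 8 e, whereas its mean over 20 transmissions is at
  -- most (1 + z p) ^ 20 ≤ 2.
  module ErrorWeight {α} (0<α : 0# < α) (α<1 : α < 1#) where

    α⁻¹ : Carrier
    α⁻¹ = recip 0<α

    0<α⁻¹ : 0# < α⁻¹
    0<α⁻¹ = proj₁ (proj₂ (inverse 0<α))

    αα⁻¹≈1 : α * α⁻¹ ≈ 1#
    αα⁻¹≈1 = proj₂ (proj₂ (inverse 0<α))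

    1≤α⁻¹ : 1# ≤ α⁻¹
    1≤α⁻¹ = begin
      1#        ≈⟨ αα⁻¹≈1 ⟨
      α * α⁻¹   ≈⟨ *-comm _ _ ⟩
      α⁻¹ * α   ≤⟨ *-monoʳ-≤ (<⇒≤ 0<α⁻¹) (<⇒≤ α<1) ⟩
      α⁻¹ * 1#  ≈⟨ *-identityʳ _ ⟩
      α⁻¹       ∎
      where open ≤-Reasoning

    z : Carrier
    z = exp₂ (fromℕ 16 * α⁻¹)

    1≤z : 1# ≤ z
    1≤z = ≤-trans (≤-reflexive (sym exp₂-0)) (exp₂-mono-≤ (*-nonneg (0≤fromℕ 16) (<⇒≤ 0<α⁻¹)))

    0≤z : 0# ≤ z
    0≤z = ≤-trans 0≤1 1≤z

    4^T≤z^e : ∀ T e → α * fromℕ T ≤ fromℕ 8 * fromℕ e → 1# ≤ z ^ e * exp₂ (- (fromℕ 2 * fromℕ T))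
    4^T≤z^e T e le = begin
      1#                                      ≈⟨ exp₂-inverseʳ _ ⟨
      exp₂ x * exp₂ (- x)                     ≤⟨ *-mono-≤ (exp₂-nonneg x) (exp₂-nonneg (- x)) (exp₂-mono-≤ x≤) ≤-refl ⟩
      exp₂ (fromℕ e * (fromℕ 16 * α⁻¹)) * exp₂ (- x)  ≈⟨ *-congʳ (exp₂-^ _ e) ⟩
      z ^ e * exp₂ (- x)                      ∎
      where
      open ≤-Reasoning
      x = fromℕ 2 * fromℕ T
      x≤ : x ≤ fromℕ e * (fromℕ 16 * α⁻¹)
      x≤ = begin
        fromℕ 2 * fromℕ T                       ≈⟨ *-identityˡ _ ⟨
        1# * (fromℕ 2 * fromℕ T)                ≈⟨ *-congʳ αα⁻¹≈1 ⟨
        α * α⁻¹ * (fromℕ 2 * fromℕ T)           ≈⟨ solve 4 (λ a b c d → a :* b :* (c :* d) ⊜ c :* b :* (a :* d)) refl α α⁻¹ (fromℕ 2) (fromℕ T) ⟩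
        fromℕ 2 * α⁻¹ * (α * fromℕ T)           ≤⟨ *-monoʳ-≤ (*-nonneg (0≤fromℕ 2) (<⇒≤ 0<α⁻¹)) le ⟩
        fromℕ 2 * α⁻¹ * (fromℕ 8 * fromℕ e)     ≈⟨ solve 4 (λ a b c d → a :* b :* (c :* d) ⊜ d :* (a :* c :* b)) refl (fromℕ 2) α⁻¹ (fromℕ 8) (fromℕ e) ⟩
        fromℕ e * (fromℕ 2 * fromℕ 8 * α⁻¹)     ≈⟨ *-congˡ (*-congʳ (fromℕ-* 2 8)) ⟨
        fromℕ e * (fromℕ 16 * α⁻¹)              ∎

    -- Twenty transmissions require 2 * 20 * z p ≤ 1. The 40 is rounded up to a power of two so that
    -- `exp₂` can absorb it.
    64zp≤1 : ∀ {p} → p ≤ exp₂ (- (fromℕ 42 * α⁻¹)) → fromℕ 64 * (z * p) ≤ 1#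
    64zp≤1 {p} p≤ = begin
      fromℕ 64 * (z * p)                            ≈⟨ *-congʳ (fromℕ-^ 2 6) ⟩
      fromℕ 2 ^ 6 * (z * p)                         ≈⟨ *-congʳ (exp₂-fromℕ 6) ⟨
      exp₂ (fromℕ 6) * (z * p)                      ≈⟨ *-assoc _ _ _ ⟨
      exp₂ (fromℕ 6) * z * p                        ≈⟨ *-congʳ (exp₂-+ _ _) ⟨
      exp₂ (fromℕ 6 + fromℕ 16 * α⁻¹) * p           ≤⟨ *-mono-≤ (exp₂-nonneg _) (exp₂-nonneg _) (exp₂-mono-≤ 6+16α⁻¹≤42α⁻¹) p≤ ⟩
      exp₂ (fromℕ 42 * α⁻¹) * exp₂ (- (fromℕ 42 * α⁻¹))  ≈⟨ exp₂-inverseʳ _ ⟩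
      1#                                            ∎
      where
      open ≤-Reasoning
      -- Of the 42, 16 cancel the exponent of `z`; the other 26 more than cover the 6 of 64 = 2 ^ 6,
      -- because 1 ≤ α⁻¹.
      6+16α⁻¹≤42α⁻¹ : fromℕ 6 + fromℕ 16 * α⁻¹ ≤ fromℕ 42 * α⁻¹
      6+16α⁻¹≤42α⁻¹ = begin
        fromℕ 6 + fromℕ 16 * α⁻¹           ≈⟨ +-congʳ (*-identityʳ _) ⟨
        fromℕ 6 * 1# + fromℕ 16 * α⁻¹      ≤⟨ +-monoˡ-≤ _ (*-mono-≤ (0≤fromℕ 6) (<⇒≤ 0<α⁻¹) (fromℕ-mono-≤ (ℕ.m≤m+n 6 20)) 1≤α⁻¹) ⟩
        fromℕ 26 * α⁻¹ + fromℕ 16 * α⁻¹    ≈⟨ distribʳ _ _ _ ⟨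
        (fromℕ 26 + fromℕ 16) * α⁻¹        ≈⟨ *-congʳ (fromℕ-+ 26 16) ⟨
        fromℕ 42 * α⁻¹                     ∎

    [1+zp]^20≤2 : ∀ {p} → 0# ≤ p → p ≤ exp₂ (- (fromℕ 42 * α⁻¹)) → (1# + z * p) ^ 20 ≤ fromℕ 2
    [1+zp]^20≤2 {p} 0≤p p≤ = [1+x]^n≤2 20 (*-nonneg 0≤z 0≤p) (begin
      fromℕ 2 * (fromℕ 20 * (z * p))  ≈⟨ *-assoc _ _ _ ⟨
      fromℕ 2 * fromℕ 20 * (z * p)    ≈⟨ *-congʳ (fromℕ-* 2 20) ⟨
      fromℕ 40 * (z * p)              ≤⟨ *-mono-≤ (0≤fromℕ 40) (*-nonneg 0≤z 0≤p) (fromℕ-mono-≤ (ℕ.m≤m+n 40 24)) ≤-refl ⟩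
      fromℕ 64 * (z * p)              ≤⟨ 64zp≤1 p≤ ⟩
      1#                              ∎)
      where open ≤-Reasoning

    -- The 20T transmissions form T blocks, each contributing a factor of at most 2; dividing 2 ^ T
    -- by the threshold 4 ^ T leaves 2 ^ -T.
    mean-weight-bound : ∀ {p} T → 0# ≤ p → p ≤ exp₂ (- (fromℕ 42 * α⁻¹)) →
      (1# + z * p) ^ (20 ℕ.* T) * exp₂ (- (fromℕ 2 * fromℕ T)) ≤ exp₂ (- (1# * fromℕ T))
    mean-weight-bound {p} T 0≤p p≤ = begin
      (1# + z * p) ^ (20 ℕ.* T) * exp₂ (- 2T)    ≈⟨ *-congʳ (^-assocʳ _ 20 T) ⟨
      ((1# + z * p) ^ 20) ^ T * exp₂ (- 2T)      ≤⟨ *-mono-≤ (^-nonneg T 0≤P) (exp₂-nonneg _) (^-monoˡ-≤ T 0≤P ([1+zp]^20≤2 0≤p p≤)) ≤-refl ⟩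
      fromℕ 2 ^ T * exp₂ (- 2T)                  ≈⟨ *-congʳ (exp₂-fromℕ T) ⟨
      exp₂ (fromℕ T) * exp₂ (- 2T)               ≈⟨ exp₂-+ _ _ ⟨
      exp₂ (fromℕ T + - 2T)                      ≤⟨ exp₂-mono-≤ (x-y≤z (≤-reflexive eq)) ⟩
      exp₂ (- (1# * fromℕ T))                    ∎
      where
      open ≤-Reasoning
      2T = fromℕ 2 * fromℕ T
      0≤P = ^-nonneg 20 (+-nonneg 0≤1 (*-nonneg 0≤z 0≤p))
      t = fromℕ T
      eq : t ≈ - (1# * t) + 2T
      eq = begin-equality
        t                          ≈⟨ +-identityˡ t ⟨
        0# + t                     ≈⟨ +-congʳ (-‿inverseˡ (1# * t)) ⟨
        - (1# * t) + 1# * t + t    ≈⟨ solve 2 (λ n t → n :+ con 1 :* t :+ t ⊜ n :+ (con 1 :+ (con 1 :+ con 0)) :* t) refl (- (1# * t)) t ⟩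
        - (1# * t) + 2T            ∎

-- Decoding errors along a path

module Coding where
  open ≡ using (refl)

  δ : ∀ {q} → Fin q → Fin q → ℕ
  δ x y with x Fin.≟ y
  ... | yes _ = 0
  ... | no  _ = 1

  hamming-∷ : ∀ {q t} (x y : Fin q) (u v : Vec (Fin q) t) →
    hamming (x ∷ u) (y ∷ v) ≡ δ x y ℕ.+ hamming u v
  hamming-∷ x y u v with x Fin.≟ y
  ... | yes _ = refl
  ... | no  _ = refl

  hamming-refl : ∀ {q t} (u : Vec (Fin q) t) → hamming u u ≡ 0
  hamming-refl []      = refl
  hamming-refl (x ∷ u) with x Fin.≟ x
  ... | yes _   = hamming-refl u
  ... | no  x≢x = contradiction refl x≢x

  hamming-sym : ∀ {q t} (u v : Vec (Fin q) t) → hamming u v ≡ hamming v u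
  hamming-sym []      []      = refl
  hamming-sym (x ∷ u) (y ∷ v) with x Fin.≟ y | y Fin.≟ x
  ... | yes _   | yes _   = hamming-sym u v
  ... | yes x≡y | no  y≢x = contradiction (≡.sym x≡y) y≢x
  ... | no  x≢y | yes y≡x = contradiction (≡.sym y≡x) x≢y
  ... | no  _   | no  _   = cong suc (hamming-sym u v)

  δ-triangle : ∀ {q} (x y z : Fin q) → δ x y ℕ.≤ δ z x ℕ.+ δ z y
  δ-triangle x y z with x Fin.≟ y | z Fin.≟ x | z Fin.≟ y
  ... | yes _   | _        | _        = z≤n
  ... | no  x≢y | yes refl | yes refl = contradiction refl x≢y
  ... | no  _   | yes _    | no  _    = s≤s z≤n
  ... | no  _   | no  _    | _        = s≤s z≤n

  -- A `Subset` indexes arcs from the root, while a path lists its latest arc first; prolonging the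
  -- path therefore appends at the far end of the subset.
  ∣p∷ʳx∣ : ∀ {n} (p : Subset n) x → ∣ p ∷ʳ x ∣ ≡ ∣ p ∣ ℕ.+ ∣ x ∷ [] ∣
  ∣p∷ʳx∣ []          x = refl
  ∣p∷ʳx∣ (true  ∷ p) x = cong suc (∣p∷ʳx∣ p x)
  ∣p∷ʳx∣ (false ∷ p) x = ∣p∷ʳx∣ p x

  ∈-∷ʳ⁻ : ∀ {n} (p : Subset n) {x i} → i ∈ p ∷ʳ x →
    (∃[ j ] j ∈ p × toℕ i ≡ toℕ j) ⊎ (toℕ i ≡ n × x ≡ true)
  ∈-∷ʳ⁻ []      here        = inj₂ (refl , refl)
  ∈-∷ʳ⁻ (y ∷ p) here        = inj₁ (Fin.zero , here , refl)
  ∈-∷ʳ⁻ (y ∷ p) (there i∈p) with ∈-∷ʳ⁻ p i∈p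
  ... | inj₁ (j , j∈p , eq) = inj₁ (Fin.suc j , there j∈p , cong suc eq)
  ... | inj₂ (eq , x≡true)  = inj₂ (cong suc eq , x≡true)

  module Decoding {q} (w : TreeCode q) (decode : ∀ {t} → Vec (Fin q) t → Vec Arc t) where

    infix 4 _≟ⱽ_
    _≟ⱽ_ : ∀ {t} → DecidableEquality (Vec Arc t)
    _≟ⱽ_ = Vec.≡-dec _≟ᴬ_

    wrong : ∀ {t} → Vec (Fin q) t → Vec Arc t → ℕ
    wrong Z Q with decode Z ≟ⱽ Q
    ... | yes _ = 0
    ... | no  _ = 1

    wrong≤1 : ∀ {t} (Z : Vec (Fin q) t) Q → wrong Z Q ℕ.≤ 1
    wrong≤1 Z Q with decode Z ≟ⱽ Q
    ... | yes _ = z≤n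
    ... | no  _ = s≤s z≤n

    wrongs : ∀ {t} → Vec (Fin q) t → Vec Arc t → ℕ
    wrongs []      _ = 0
    wrongs (z ∷ Z) Q = wrong (z ∷ Z) Q ℕ.+ wrongs Z (tail Q)

    divergence-≢ : ∀ {t a b} {u v : Vec Arc t} → a ∷ u ≢ b ∷ v →
      divergence (a ∷ u) (b ∷ v) ≡ suc (divergence u v)
    divergence-≢ {a = a} {b} {u} {v} neq with Vec.≡-dec _≟ᴬ_ (a ∷ u) (b ∷ v)
    ... | yes eq = contradiction eq neq
    ... | no  _ = refl

    divergence-refl : ∀ {t} (u : Vec Arc t) → divergence u u ≡ 0
    divergence-refl []      = refl
    divergence-refl (a ∷ u) with Vec.≡-dec _≟ᴬ_ (a ∷ u) (a ∷ u)
    ... | yes _ = refl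
    ... | no neq = contradiction refl neq

    -- The intervals of α-heavy error density ending at wrongly decoded rounds
    -- are handled by a discrete rising sun lemma: a wrongly decoded round at
    -- divergence ℓ is charged, together with the ℓ - 1 rounds before it, to the
    -- at least αℓ/2 errors in these ℓ rounds, and the remaining rounds form a
    -- shorter prefix.
    module _ {c ℓ₁ ℓ₂} (ℛ : Reals c ℓ₁ ℓ₂) where
      open Reals ℛ
      open RealProperties ℛ hiding (refl)
      private module ℝ = RealProperties ℛ

      module Charging (α : Carrier) (0≤α : 0# ≤ α) where

        OnBad : ∀ {t} → Vec Arc t → Subset t → Set ℓ₂
        OnBad Q J = ∀ {i} → i ∈ J → OnBadSubpath ℛ α w Q (suc (toℕ i))

        -- The invariant of the charging: each wrong round is paid for by an arc on a bad subpath or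
        -- by errors, one error being worth 2/α rounds. Multiplying through by α avoids the
        -- division.
        record Covered {t} (Q : Vec Arc t) (m x : ℕ) : Set ℓ₂ where
          constructor covered
          field
            {bad}  : Subset t
            onBad  : OnBad Q bad
            charge : α * fromℕ m ≤ α * fromℕ ∣ bad ∣ + fromℕ 2 * fromℕ x

        -- Course-of-values induction: a charge may reach back to any earlier prefix, so the covers
        -- of all prefixes are kept.
        AllCovered : ∀ {t} → Vec (Fin q) t → Vec Arc t → Set ℓ₂
        AllCovered []          []          = Covered [] 0 0
        AllCovered Z@(_ ∷ Z′) Q@(_ ∷ Q′) = Covered Q (wrongs Z Q) (hamming Z (W w Q)) × AllCovered Z′ Q′

        extend : ∀ {t a m x} {Q : Vec Arc t} → Covered Q m x → Covered (a ∷ Q) m x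
        extend {a = a} {m} {x} {Q} (covered {J} onBad charge) = covered {bad = J ∷ʳ false} onBad′
          (≡.subst (λ j → α * fromℕ m ≤ α * fromℕ j + fromℕ 2 * fromℕ x)
            (≡.sym (≡.trans (∣p∷ʳx∣ J false) (ℕ.+-identityʳ _))) charge)
          where
          onBad′ : OnBad (a ∷ Q) (J ∷ʳ false)
          onBad′ i∈ with ∈-∷ʳ⁻ J i∈
          ... | inj₁ (j , j∈J , eq) =
            let h , u , v , u≼Q , rest = onBad j∈J
            in ≡.subst (OnBadSubpath ℛ α w (a ∷ Q) ∘ suc) (≡.sym eq) (h , u , v , up u≼Q , rest)

        -- Going back from `Q` and `g` to their least common ancestor leaves a prefix with cover
        -- `cover`. Up to there both label sequences agree, so its errors count once against each of
        -- them, whence the factor 2; after it the triangle inequality applies.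
        record Jump {t} (Z : Vec (Fin q) t) (Q g : Vec Arc t) : Set ℓ₂ where
          constructor jump
          field
            {rest errors} : ℕ
            cover         : Covered Q rest errors
            wrongs≤       : wrongs Z Q ℕ.≤ divergence Q g ℕ.+ rest
            errors≤       : hamming (W w Q) (W w g) ℕ.+ 2 ℕ.* errors ℕ.≤
                            hamming Z (W w Q) ℕ.+ hamming Z (W w g)

        jump-∷ : ∀ {t z a b} {Z : Vec (Fin q) t} {Q g} → a ∷ Q ≢ b ∷ g →
          Jump Z Q g → Jump (z ∷ Z) (a ∷ Q) (b ∷ g)
        jump-∷ {z = z} {a} {b} {Z} {Q} {g} neq (jump {m} {e} cover wrongs≤ errors≤) = jump (extend cover)
          (begin
            wrong (z ∷ Z) (a ∷ Q) ℕ.+ wrongs Z Q      ≤⟨ ℕ.+-mono-≤ (wrong≤1 (z ∷ Z) (a ∷ Q)) wrongs≤ ⟩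
            suc (divergence Q g ℕ.+ m)                 ≡⟨ cong (ℕ._+ m) (divergence-≢ neq) ⟨
            divergence (a ∷ Q) (b ∷ g) ℕ.+ m           ∎)
          (begin
            hamming (x ∷ W w Q) (y ∷ W w g) ℕ.+ 2 ℕ.* e                      ≡⟨ cong (ℕ._+ 2 ℕ.* e) (hamming-∷ x y _ _) ⟩
            δ x y ℕ.+ hamming (W w Q) (W w g) ℕ.+ 2 ℕ.* e                    ≡⟨ ℕ.+-assoc (δ x y) _ _ ⟩
            δ x y ℕ.+ (hamming (W w Q) (W w g) ℕ.+ 2 ℕ.* e)                  ≤⟨ ℕ.+-mono-≤ (δ-triangle x y z) errors≤ ⟩
            δ z x ℕ.+ δ z y ℕ.+ (hamming Z (W w Q) ℕ.+ hamming Z (W w g))    ≡⟨ shuffle (δ z x) (δ z y) _ _ ⟩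
            δ z x ℕ.+ hamming Z (W w Q) ℕ.+ (δ z y ℕ.+ hamming Z (W w g))    ≡⟨ ≡.cong₂ ℕ._+_ (hamming-∷ z x Z _) (hamming-∷ z y Z _) ⟨
            hamming (z ∷ Z) (x ∷ W w Q) ℕ.+ hamming (z ∷ Z) (y ∷ W w g)      ∎)
          where
          open ℕ.≤-Reasoning
          x = w (a ∷ Q)
          y = w (b ∷ g)
          shuffle : ∀ a b c d → a ℕ.+ b ℕ.+ (c ℕ.+ d) ≡ a ℕ.+ c ℕ.+ (b ℕ.+ d)
          shuffle = solve-∀

        jump-refl : ∀ {t} (Z : Vec (Fin q) t) {Q} →
          Covered Q (wrongs Z Q) (hamming Z (W w Q)) → Jump Z Q Q
        jump-refl Z {Q} cover = jump cover
          (ℕ.≤-reflexive (cong (ℕ._+ wrongs Z Q) (≡.sym (divergence-refl Q))))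
          (ℕ.≤-reflexive (≡.cong₂ ℕ._+_ (hamming-refl (W w Q)) (cong (hamming Z (W w Q) ℕ.+_) (ℕ.+-identityʳ _))))

        findJump : ∀ {t} (Z : Vec (Fin q) t) Q g → AllCovered Z Q → Jump Z Q g
        findJump []      []      []      cov         = jump-refl [] cov
        findJump (z ∷ Z) (a ∷ Q) (b ∷ g) (cov , all) with a ∷ Q ≟ⱽ b ∷ g
        ... | yes refl = jump-refl (z ∷ Z) cov
        ... | no neq   = jump-∷ neq (findJump Z Q g all)

        -- As the decoder preferred `g`, at least half of the distance between the two paths
        -- consists of errors made after their least common ancestor. That distance is at least αℓ
        -- because the pair is not bad, so these errors pay for all of the last ℓ rounds.
        charge-jump : ∀ {t} {Z : Vec (Fin q) t} {Q g} →
          hamming (W w g) Z ℕ.≤ hamming (W w Q) Z → ¬ Bad ℛ α w Q g →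
          Jump Z Q g → Covered Q (wrongs Z Q) (hamming Z (W w Q))
        charge-jump {Z = Z} {Q} {g} nearest notBad (jump {m} {e} (covered {J} onBad charge) wrongs≤ errors≤) =
          covered onBad (begin
            α * fromℕ (wrongs Z Q)                    ≤⟨ *-monoʳ-≤ 0≤α (fromℕ-mono-≤ wrongs≤) ⟩
            α * fromℕ (ℓ ℕ.+ m)                       ≈⟨ *-congˡ (fromℕ-+ ℓ m) ⟩
            α * (fromℕ ℓ + fromℕ m)                   ≈⟨ distribˡ _ _ _ ⟩
            α * fromℕ ℓ + α * fromℕ m                 ≤⟨ +-mono-≤ notBad charge ⟩
            fromℕ d + (J′ + fromℕ 2 * fromℕ e)        ≈⟨ solve 3 (λ d j e → d :+ (j :+ e) ⊜ j :+ (d :+ e)) ℝ.refl _ _ _ ⟩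
            J′ + (fromℕ d + fromℕ 2 * fromℕ e)        ≈⟨ +-congˡ (+-congˡ (fromℕ-* 2 e)) ⟨
            J′ + (fromℕ d + fromℕ (2 ℕ.* e))          ≈⟨ +-congˡ (fromℕ-+ d (2 ℕ.* e)) ⟨
            J′ + fromℕ (d ℕ.+ 2 ℕ.* e)                ≤⟨ +-mono-≤ ≤-refl (fromℕ-mono-≤ d+2e≤2x) ⟩
            J′ + fromℕ (2 ℕ.* x)                      ≈⟨ +-congˡ (fromℕ-* 2 x) ⟩
            J′ + fromℕ 2 * fromℕ x                    ∎)
          where
          open ≤-Reasoning
          ℓ = divergence Q g
          d = hamming (W w Q) (W w g)
          x = hamming Z (W w Q)
          J′ = α * fromℕ ∣ J ∣
          d+2e≤2x : d ℕ.+ 2 ℕ.* e ℕ.≤ 2 ℕ.* x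
          d+2e≤2x = ℕ.≤-trans errors≤ (ℕ.+-monoʳ-≤ x (ℕ.≤-trans
            (≡.subst₂ ℕ._≤_ (hamming-sym (W w g) Z) (hamming-sym (W w Q) Z) nearest)
            (ℕ.≤-reflexive (≡.sym (ℕ.+-identityʳ x)))))

        -- A single round is charged here, to its own arc, which is added to the set; the rest is
        -- the cover of the prefix one round shorter.
        charge-bad : ∀ {t} {z a} {Z : Vec (Fin q) t} {Q} {g : Vec Arc (suc t)} → g ≢ a ∷ Q → Bad ℛ α w (a ∷ Q) g →
          Covered Q (wrongs Z Q) (hamming Z (W w Q)) →
          Covered (a ∷ Q) (wrongs (z ∷ Z) (a ∷ Q)) (hamming (z ∷ Z) (W w (a ∷ Q)))
        charge-bad {t} {z} {a} {Z} {Q} {b ∷ g} g≢ isBad (covered {J} onBad charge) = covered {bad = J ∷ʳ true} onBad′ (begin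
            α * fromℕ (wrongs (z ∷ Z) (a ∷ Q))        ≤⟨ *-monoʳ-≤ 0≤α (fromℕ-mono-≤ (ℕ.+-monoˡ-≤ (wrongs Z Q) (wrong≤1 (z ∷ Z) (a ∷ Q)))) ⟩
            α * (1# + fromℕ (wrongs Z Q))             ≈⟨ distribˡ _ _ _ ⟩
            α * 1# + α * fromℕ (wrongs Z Q)           ≤⟨ +-mono-≤ ≤-refl charge ⟩
            α * 1# + (α * fromℕ ∣ J ∣ + fromℕ 2 * fromℕ (hamming Z (W w Q)))
              ≈⟨ solve 3 (λ α j e → α :* con 1 :+ (α :* j :+ e) ⊜ α :* (con 1 :+ j) :+ e) ℝ.refl α (fromℕ ∣ J ∣) _ ⟩
            α * fromℕ (suc ∣ J ∣) + fromℕ 2 * fromℕ (hamming Z (W w Q))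
              ≤⟨ +-mono-≤ (≤-reflexive (*-congˡ (≤-antisym (fromℕ-mono-≤ (ℕ.≤-reflexive ∣J′∣)) (fromℕ-mono-≤ (ℕ.≤-reflexive (≡.sym ∣J′∣))))))
                   (*-monoʳ-≤ (0≤fromℕ 2) (fromℕ-mono-≤ x≤)) ⟩
            α * fromℕ ∣ J ∷ʳ true ∣ + fromℕ 2 * fromℕ (hamming (z ∷ Z) (W w (a ∷ Q)))  ∎)
          where
          open ≤-Reasoning
          ∣J′∣ : suc ∣ J ∣ ≡ ∣ J ∷ʳ true ∣
          ∣J′∣ = ≡.trans (ℕ.+-comm 1 _) (≡.sym (∣p∷ʳx∣ J true))
          x≤ : hamming Z (W w Q) ℕ.≤ hamming (z ∷ Z) (W w (a ∷ Q))
          x≤ = ℕ.≤-trans (ℕ.m≤n+m _ (δ z (w (a ∷ Q)))) (ℕ.≤-reflexive (≡.sym (hamming-∷ z _ Z _)))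
          onBad′ : OnBad (a ∷ Q) (J ∷ʳ true)
          onBad′ i∈ with ∈-∷ʳ⁻ J i∈
          ... | inj₁ (j , j∈J , eq) =
            let h , u , v , u≼Q , rest = onBad j∈J
            in ≡.subst (OnBadSubpath ℛ α w (a ∷ Q) ∘ suc) (≡.sym eq) (h , u , v , up u≼Q , rest)
          -- The bad subpath ends with the new arc. It does contain that arc: its length, the
          -- divergence, is positive since `g` differs from the path.
          ... | inj₂ (eq , _) = ≡.subst (OnBadSubpath ℛ α w (a ∷ Q) ∘ suc) (≡.sym eq)
            (suc t , a ∷ Q , b ∷ g , here , isBad ,
             ℕ.m<m+n (suc t) (≡.subst (0 ℕ.<_) (≡.sym (divergence-≢ (g≢ ∘ ≡.sym))) (s≤s z≤n)) , ℕ.≤-refl)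

        charge-correct : ∀ {t} {z a} {Z : Vec (Fin q) t} {Q} → decode (z ∷ Z) ≡ a ∷ Q →
          Covered Q (wrongs Z Q) (hamming Z (W w Q)) →
          Covered (a ∷ Q) (wrongs (z ∷ Z) (a ∷ Q)) (hamming (z ∷ Z) (W w (a ∷ Q)))
        charge-correct {z = z} {a} {Z} {Q} eq cov with decode (z ∷ Z) ≟ⱽ a ∷ Q
        ... | no neq = contradiction eq neq
        ... | yes _ = covered (onBad (extend cov)) (≤-trans (charge (extend {a = a} cov))
          (+-mono-≤ ≤-refl (*-monoʳ-≤ (0≤fromℕ 2) (fromℕ-mono-≤ (ℕ.≤-trans (ℕ.m≤n+m _ (δ z (w (a ∷ Q))))
            (ℕ.≤-reflexive (≡.sym (hamming-∷ z _ Z _))))))))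
          where open Covered

        covered-last : ∀ {t} (Z : Vec (Fin q) t) Q → AllCovered Z Q → Covered Q (wrongs Z Q) (hamming Z (W w Q))
        covered-last []      []      cov       = cov
        covered-last (_ ∷ _) (_ ∷ _) (cov , _) = cov

        -- Whether the decoded node forms a bad pair with the true one is a strict inequality
        -- between reals, hence the double negation. Its negative case is literally the lower bound
        -- on the distance that `charge-jump` uses.
        allCovered : ∀ {N} → IsDecoder N w decode → ∀ {t} → t ℕ.≤ N →
          (Z : Vec (Fin q) t) (Q : Vec Arc t) → ¬ ¬ AllCovered Z Q
        allCovered dec _  []      []      k = k (covered {bad = []} (λ ()) (x≤x+y (*-nonneg (0≤fromℕ 2) ≤-refl)))
        allCovered dec t≤N (z ∷ Z) (a ∷ Q) k = allCovered dec (ℕ.<⇒≤ t≤N) Z Q λ all → step all (g ≟ⱽ a ∷ Q)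
          where
          g = decode (z ∷ Z)
          -- The cover at the current round is what is being constructed, so this round is peeled
          -- off before the search among the earlier prefixes.
          toJump : AllCovered Z Q → (g : Vec Arc _) → a ∷ Q ≢ g → Jump (z ∷ Z) (a ∷ Q) g
          toJump all (b ∷ g) neq = jump-∷ neq (findJump Z Q g all)
          step : AllCovered Z Q → Dec (g ≡ a ∷ Q) → ⊥
          step all (yes eq) = k (charge-correct eq (covered-last Z Q all) , all)
          step all (no neq) = ¬¬-excluded-middle λ where
            (yes bad)   → k (charge-bad neq bad (covered-last Z Q all) , all)
            (no notBad) → k (charge-jump (dec t≤N (z ∷ Z) (a ∷ Q)) notBad (toJump all g (neq ∘ ≡.sym)) , all)

        wrongs-bound : ∀ T → IsDecoder (10 ℕ.* T) w decode → Potent ℛ (10 ℕ.* T) (recip (0<fromℕ 9)) α w →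
          ∀ Z Q → α * fromℕ (wrongs Z Q) ≤ α * fromℕ T + fromℕ 2 * fromℕ (hamming Z (W w Q))
        wrongs-bound T dec potent Z Q lt = allCovered dec ℕ.≤-refl Z Q λ all →
          let covered {J} onBad charge = covered-last Z Q all
          in ≤-trans charge (+-monoˡ-≤ _ (*-monoʳ-≤ 0≤α (<⇒≤ (<-≤-trans (potent Q J onBad) (≤-reflexive tenth))))) lt
          where
          open ≤-Reasoning
          -- `0<fromℕ 9` states that 10 is positive, so this reciprocal is 1/10.
          tenth : recip (0<fromℕ 9) * fromℕ (10 ℕ.* T) ≈ fromℕ T
          tenth = begin-equality
            recip (0<fromℕ 9) * fromℕ (10 ℕ.* T)         ≈⟨ *-congˡ (fromℕ-* 10 T) ⟩
            recip (0<fromℕ 9) * (fromℕ 10 * fromℕ T)     ≈⟨ *-assoc _ _ _ ⟨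
            recip (0<fromℕ 9) * fromℕ 10 * fromℕ T       ≈⟨ *-congʳ (*-comm _ _) ⟩
            fromℕ 10 * recip (0<fromℕ 9) * fromℕ T       ≈⟨ *-congʳ (proj₂ (proj₂ (inverse (0<fromℕ 9)))) ⟩
            1# * fromℕ T                                 ≈⟨ *-identityˡ _ ⟩
            fromℕ T                                      ∎

open Coding

-- The movement of the pebbles

module Pebbles where
  open import Data.Nat using (_+_; _*_; _≤_; _<_)
  open import Data.Nat.Properties
  open ≡ using (refl; sym; trans)

  ⊑-refl : ∀ {u} → u ⊑ u
  ⊑-refl = Suffix.here (≡⇒Pointwise-≡ refl)

  ⊑-trans : ∀ {u v w} → u ⊑ v → v ⊑ w → u ⊑ w
  ⊑-trans = Suffix.trans trans

  []⊑ : ∀ v → [] ⊑ v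
  []⊑ []      = ⊑-refl
  []⊑ (m ∷ v) = Suffix.there ([]⊑ v)

  ⊑-∷⁻ : ∀ {u m v} → u ⊑ (m ∷ v) → u ≡ m ∷ v ⊎ u ⊑ v
  ⊑-∷⁻ (Suffix.here eq)   = inj₁ (Pointwise-≡⇒≡ eq)
  ⊑-∷⁻ (Suffix.there u⊑v) = inj₂ u⊑v

  parent-⊑ : ∀ u → parent u ⊑ u
  parent-⊑ []      = ⊑-refl
  parent-⊑ (m ∷ u) = Suffix.there ⊑-refl

  parent-mono-⊑ : ∀ {u} v → u ⊑ v → parent u ⊑ parent v
  parent-mono-⊑ {u} [] u⊑v = ⊑-trans (parent-⊑ u) u⊑v
  parent-mono-⊑ {u} (m ∷ v) u⊑v with ⊑-∷⁻ u⊑v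
  ... | inj₁ refl = ⊑-refl
  ... | inj₂ u⊑v′ = ⊑-trans (parent-⊑ u) u⊑v′

  ⊑∧≢⇒⊑parent : ∀ {u} v → u ⊑ v → u ≢ v → u ⊑ parent v
  ⊑∧≢⇒⊑parent []      u⊑v _   = u⊑v
  ⊑∧≢⇒⊑parent (m ∷ v) u⊑v u≢v with ⊑-∷⁻ u⊑v
  ... | inj₁ u≡v = contradiction u≡v u≢v
  ... | inj₂ u⊑v′ = u⊑v′

  lca-⊑ˡ : ∀ u v → lca u v ⊑ u
  lca-⊑ˡ []      v = ⊑-refl
  lca-⊑ˡ (m ∷ u) v with (m ∷ u) ⊑? v
  ... | yes _ = ⊑-refl
  ... | no  _ = Suffix.there (lca-⊑ˡ u v)

  lca-⊑ʳ : ∀ u v → lca u v ⊑ v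
  lca-⊑ʳ []      v = []⊑ v
  lca-⊑ʳ (m ∷ u) v with (m ∷ u) ⊑? v
  ... | yes u⊑v = u⊑v
  ... | no  _   = lca-⊑ʳ u v

  lca-greatest : ∀ {w} u v → w ⊑ u → w ⊑ v → length w ≤ length (lca u v)
  lca-greatest []      v w⊑u w⊑v = Suffix.length-mono w⊑u
  lca-greatest (m ∷ u) v w⊑u w⊑v with (m ∷ u) ⊑? v
  ... | yes _   = Suffix.length-mono w⊑u
  ... | no  u⋢v with ⊑-∷⁻ w⊑u
  ...   | inj₁ refl = contradiction w⊑v u⋢v
  ...   | inj₂ w⊑u′ = lca-greatest u v w⊑u′ w⊑v

  length-parent : ∀ u → length u ≤ suc (length (parent u))
  length-parent []      = z≤n
  length-parent (m ∷ u) = ≤-refl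

  length-move : ∀ m u → length (move m u) ≤ suc (length u)
  length-move (to x) u = ≤-refl
  length-move H      u = n≤1+n _
  length-move B      u = m≤n⇒m≤1+n (Suffix.length-mono (parent-⊑ u))

  parent⊑move : ∀ m u → parent u ⊑ move m u
  parent⊑move (to x) u = Suffix.there (parent-⊑ u)
  parent⊑move H      u = parent-⊑ u
  parent⊑move B      u = ⊑-refl

  -- No move takes a pebble out of the subtree below the parent of its old position, so the parent
  -- of the old least common ancestor is still a common ancestor.
  lca-move : ∀ m n u v → length (lca u v) ≤ suc (length (lca (move m u) (move n v)))
  lca-move m n u v = ≤-trans (length-parent (lca u v)) (s≤s (lca-greatest (move m u) (move n v)
    (⊑-trans (parent-mono-⊑ u (lca-⊑ˡ u v)) (parent⊑move m u))
    (⊑-trans (parent-mono-⊑ v (lca-⊑ʳ u v)) (parent⊑move n v))))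

  -- The mark of the pebbles u and v is at least t - 4k.
  record Mark (t k : ℕ) (u v : Node) : Set where
    constructor mark
    field
      markˡ : t + length u ≤ 2 * length (lca u v) + 4 * k
      markʳ : t + length v ≤ 2 * length (lca u v) + 4 * k

  -- Twice the common depth drops by at most 2, the depth of a pebble grows by at most 1, and t
  -- grows by 1: together the 4 granted by `suc k`.
  mark-bad : ∀ {t k} m n u v → Mark t k u v → Mark (suc t) (suc k) (move m u) (move n v)
  mark-bad {t} {k} m n u v (mark l r) = mark (bound m u l) (bound n v r)
    where
    open ≤-Reasoning
    L  = length (lca u v)
    L′ = length (lca (move m u) (move n v))
    shuffle₁ : ∀ t x → suc t + suc x ≡ t + x + 2
    shuffle₁ = solve-∀
    shuffle₂ : ∀ L k → 2 * suc L + 4 * k + 2 ≡ 2 * L + 4 * suc k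
    shuffle₂ = solve-∀
    bound : ∀ o x → t + length x ≤ 2 * L + 4 * k → suc t + length (move o x) ≤ 2 * L′ + 4 * suc k
    bound o x le = begin
      suc t + length (move o x)  ≤⟨ +-monoʳ-≤ (suc t) (length-move o x) ⟩
      suc t + suc (length x)     ≡⟨ shuffle₁ t (length x) ⟩
      t + length x + 2           ≤⟨ +-monoˡ-≤ 2 le ⟩
      2 * L + 4 * k + 2          ≤⟨ +-monoˡ-≤ 2 (+-monoˡ-≤ (4 * k) (*-monoʳ-≤ 2 (lca-move m n u v))) ⟩
      2 * suc L′ + 4 * k + 2     ≡⟨ shuffle₂ L′ k ⟩
      2 * L′ + 4 * suc k         ∎

  -- The least common ancestor is no deeper than either pebble, so its depth is at least the mark.
  mark-depth : ∀ {t k u v} → Mark t k u v → t ≤ length (lca u v) + 4 * k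
  mark-depth {t} {k} {u} {v} (mark l _) = +-cancelʳ-≤ L t (L + 4 * k) (begin
    t + L               ≤⟨ +-monoʳ-≤ t (Suffix.length-mono (lca-⊑ˡ u v)) ⟩
    t + length u        ≤⟨ l ⟩
    2 * L + 4 * k       ≡⟨ shuffle L k ⟩
    L + 4 * k + L       ∎)
    where
    open ≤-Reasoning
    L = length (lca u v)
    shuffle : ∀ L k → 2 * L + 4 * k ≡ L + 4 * k + L
    shuffle = solve-∀

  -- Twice the common depth gains 2, the depth of each pebble only 1.
  mark-advance : ∀ {t k} m u → Mark t k u u → Mark (suc t) k (m ∷ u) (m ∷ u)
  mark-advance {t} {k} m u (mark l _) = mark le le
    where
    open ≤-Reasoning
    shuffle : ∀ t x → suc t + suc x ≡ t + x + 2
    shuffle = solve-∀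
    shuffle′ : ∀ L k → 2 * L + 4 * k + 2 ≡ 2 * suc L + 4 * k
    shuffle′ = solve-∀
    le : suc t + suc (length u) ≤ 2 * length (lca (m ∷ u) (m ∷ u)) + 4 * k
    le = begin
      suc t + suc (length u)        ≡⟨ shuffle t (length u) ⟩
      t + length u + 2              ≤⟨ +-monoˡ-≤ 2 l ⟩
      2 * length (lca u u) + 4 * k + 2    ≤⟨ +-monoˡ-≤ 2 (+-monoˡ-≤ (4 * k) (*-monoʳ-≤ 2 (Suffix.length-mono (lca-⊑ˡ u u)))) ⟩
      2 * length u + 4 * k + 2      ≡⟨ shuffle′ (length u) k ⟩
      2 * suc (length u) + 4 * k    ≤⟨ +-monoˡ-≤ (4 * k) (*-monoʳ-≤ 2 (lca-greatest (m ∷ u) (m ∷ u) ⊑-refl ⊑-refl)) ⟩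
      2 * length (lca (m ∷ u) (m ∷ u)) + 4 * k  ∎

  length-parent-⋢ : ∀ {u v} → ¬ (u ⊑ v) → suc (length (parent u)) ≡ length u
  length-parent-⋢ {[]}    {v} u⋢v = contradiction ([]⊑ v) u⋢v
  length-parent-⋢ {m ∷ u}     _   = refl

  -- The least common ancestor lies strictly above both pebbles, so it survives while both depths
  -- drop.
  mark-retreat : ∀ {t k u v} → ¬ (u ⊑ v) → ¬ (v ⊑ u) → Mark t k u v →
    Mark (suc t) k (parent u) (parent v)
  mark-retreat {t} {k} {u} {v} u⋢v v⋢u (mark l r) = mark (bound u⋢v l) (bound v⋢u r)
    where
    open ≤-Reasoning
    L  = length (lca u v)
    L′ = length (lca (parent u) (parent v))
    L≤L′ : L ≤ L′
    L≤L′ = lca-greatest (parent u) (parent v)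
      (⊑∧≢⇒⊑parent u (lca-⊑ˡ u v) λ eq → u⋢v (subst (_⊑ v) eq (lca-⊑ʳ u v)))
      (⊑∧≢⇒⊑parent v (lca-⊑ʳ u v) λ eq → v⋢u (subst (_⊑ u) eq (lca-⊑ˡ u v)))
    bound : ∀ {x y} → ¬ (x ⊑ y) → t + length x ≤ 2 * L + 4 * k → suc t + length (parent x) ≤ 2 * L′ + 4 * k
    bound {x} x⋢y le = begin
      suc t + length (parent x)    ≡⟨ +-suc t _ ⟨
      t + suc (length (parent x))  ≡⟨ cong (t +_) (length-parent-⋢ x⋢y) ⟩
      t + length x                 ≤⟨ le ⟩
      2 * L + 4 * k                ≤⟨ +-monoˡ-≤ (4 * k) (*-monoʳ-≤ 2 L≤L′) ⟩
      2 * L′ + 4 * k               ∎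

  mark-sym : ∀ {t k} u v → Mark t k u v → Mark t k v u
  mark-sym {t} {k} u v (mark l r) = mark (≤-trans r le) (≤-trans l le)
    where
    le : 2 * length (lca u v) + 4 * k ≤ 2 * length (lca v u) + 4 * k
    le = +-monoˡ-≤ (4 * k) (*-monoʳ-≤ 2 (lca-greatest v u (lca-⊑ʳ u v) (lca-⊑ˡ u v)))

  -- The ancestor `u` is itself the least common ancestor and remains so. Only the deeper pebble
  -- matters: the old bound for `v` yields both new ones, because `u` is strictly shallower than
  -- `v`.
  mark-wait : ∀ {t k u v} → u ⊑ v → ¬ (v ⊑ u) → Mark t k u v → Mark (suc t) k u (parent v)
  mark-wait {t} {k} {u} {v} u⊑v v⋢u (mark l r) = mark
    (begin
      suc t + length u             ≡⟨ +-suc t _ ⟨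
      t + suc (length u)           ≤⟨ +-monoʳ-≤ t (≤-trans (s≤s (Suffix.length-mono u⊑v′)) (≤-reflexive (length-parent-⋢ v⋢u))) ⟩
      t + length v                 ≤⟨ r′ ⟩
      2 * L′ + 4 * k               ∎)
    (begin
      suc t + length (parent v)    ≡⟨ +-suc t _ ⟨
      t + suc (length (parent v))  ≡⟨ cong (t +_) (length-parent-⋢ v⋢u) ⟩
      t + length v                 ≤⟨ r′ ⟩
      2 * L′ + 4 * k               ∎)
    where
    open ≤-Reasoning
    u⊑v′ = ⊑∧≢⇒⊑parent v u⊑v λ { refl → v⋢u ⊑-refl }
    L′ = length (lca u (parent v))
    r′ : t + length v ≤ 2 * L′ + 4 * k
    r′ = ≤-trans r (+-monoˡ-≤ (4 * k) (*-monoʳ-≤ 2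
      (≤-trans (Suffix.length-mono (lca-⊑ˡ u v)) (lca-greatest u (parent v) ⊑-refl u⊑v′))))

  -- Invariants of the simulation

  module Analysis {q} (w : TreeCode q) (decode : ∀ {t} → Vec (Fin q) t → Vec Arc t)
                  (next : Party → Node → Bool) where
    open Sim w decode next
    open Decoding w decode

    -- The local case distinction of `update`, with the alleged position and bit as arguments, so
    -- that the true ones can be put in their place after a correct decoding.
    respond : Party → (v y : Node) (b : Bool) → Dec (v ≡ y) → Dec (v ⊑ y) → Move
    respond i v y b (yes _) _       = to (message i (next i v) b)
    respond i v y b (no _)  (yes _) = H
    respond i v y b (no _)  (no _)  = B

    response : Party → (v y : Node) → Bool → Move
    response i v y b = respond i v y b (v ≟ᴺ y) (v ⊑? y)

    advance : Party → ∀ {t} → Local t → Fin q → Move → Local (suc t)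
    advance i ⟨ v , s , Z ⟩ z m = ⟨ move m v , (m , next i (move m v)) ∷ s , z ∷ Z ⟩

    follow : Party → ∀ {t} → Node → Vec Arc (suc t) → Move
    follow i v g = response i v (pebble g) (proj₂ (head g))

    update-follow : ∀ i {t} (L : Local t) z →
      update i L z ≡ advance i L z (follow i (position L) (decode (z ∷ received L)))
    update-follow i ⟨ v , s , Z ⟩ z with v ≟ᴺ pebble (decode (z ∷ Z)) | v ⊑? pebble (decode (z ∷ Z))
    ... | yes _ | _     = refl
    ... | no _  | yes _ = refl
    ... | no _  | no _  = refl

    received-local : ∀ i {t} (Z : Vec (Fin q) t) → received (local i Z) ≡ Z
    received-local i []      = refl
    received-local i (z ∷ Z) = trans (cong received (update-follow i (local i Z) z)) (cong (z ∷_) (received-local i Z))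

    moveOf : Party → ∀ {t} → Vec (Fin q) (suc t) → Move
    moveOf i Z = follow i (position (local i (tail Z))) (decode Z)

    local-∷ : ∀ i {t} z (Z : Vec (Fin q) t) → local i (z ∷ Z) ≡ advance i (local i Z) z (moveOf i (z ∷ Z))
    local-∷ i z Z = trans (update-follow i (local i Z) z)
      (cong (λ Z′ → advance i (local i Z) z (follow i (position (local i Z)) (decode (z ∷ Z′)))) (received-local i Z))

    position-∷ : ∀ i {t} z (Z : Vec (Fin q) t) →
      position (local i (z ∷ Z)) ≡ move (moveOf i (z ∷ Z)) (position (local i Z))
    position-∷ i z Z = cong position (local-∷ i z Z)

    tail-state-∷ : ∀ i {t} z (Z : Vec (Fin q) t) → tail (state (local i (z ∷ Z))) ≡ state (local i Z)
    tail-state-∷ i z Z = cong (tail ∘ state) (local-∷ i z Z)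

    -- Together with `bit-state`, this turns a correctly decoded state into the true position and
    -- the true bit of the other user.
    pebble-state : ∀ i {t} (Z : Vec (Fin q) t) → pebble (state (local i Z)) ≡ position (local i Z)
    pebble-state i []      = refl
    pebble-state i (z ∷ Z) = begin
      pebble (state (local i (z ∷ Z)))            ≡⟨ cong (pebble ∘ state) (local-∷ i z Z) ⟩
      move m (pebble (state (local i Z)))         ≡⟨ cong (move m) (pebble-state i Z) ⟩
      move m (position (local i Z))               ≡⟨ position-∷ i z Z ⟨
      position (local i (z ∷ Z))                  ∎
      where
      open ≡.≡-Reasoning
      m = moveOf i (z ∷ Z)

    bit-state : ∀ i {t} (Z : Vec (Fin q) t) → proj₂ (head (state (local i Z))) ≡ next i (position (local i Z))
    bit-state i []      = refl
    bit-state i (z ∷ Z) = trans (cong (proj₂ ∘ head ∘ state) (local-∷ i z Z))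
      (cong (next i) (sym (position-∷ i z Z)))

    own : Party → Msg → Bool
    own A = proj₁
    own B = proj₂

    own-message : ∀ i b b′ → own i (message i b b′) ≡ b
    own-message A b b′ = refl
    own-message B b b′ = refl

    -- A decoding error corrupts only the other user's component of an arc, so each pebble stays
    -- honest for its owner whatever is received. A common ancestor of both pebbles is honest for
    -- both users, which puts it on the noiseless path.
    Honest : Party → Node → Set
    Honest i u = ∀ {m y} → (m ∷ y) ⊑ u → own i m ≡ next i y

    honest-⊑ : ∀ {i u v} → u ⊑ v → Honest i v → Honest i u
    honest-⊑ u⊑v hv m∷y⊑u = hv (⊑-trans m∷y⊑u u⊑v)

    honest-follow : ∀ i {t} v (g : Vec Arc (suc t)) → Honest i v → Honest i (move (follow i v g) v)
    honest-follow i v g hv with v ≟ᴺ pebble g | v ⊑? pebble g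
    ... | no _  | yes _ = hv
    ... | no _  | no _  = honest-⊑ (parent-⊑ v) hv
    ... | yes _ | _     = λ m∷y⊑ → case (⊑-∷⁻ m∷y⊑)
      where
      case : ∀ {m y} → m ∷ y ≡ message i (next i v) (proj₂ (head g)) ∷ v ⊎ (m ∷ y) ⊑ v → own i m ≡ next i y
      case (inj₁ refl) = own-message i _ _
      case (inj₂ m∷y⊑v) = hv m∷y⊑v

    honest-local : ∀ i {t} (Z : Vec (Fin q) t) → Honest i (position (local i Z))
    honest-local i []      (Suffix.here ())
    honest-local i (z ∷ Z) = subst (Honest i) (sym (position-∷ i z Z))
      (honest-follow i (position (local i Z)) (decode (z ∷ Z)) (honest-local i Z))

    honest⇒noiseless : ∀ u → Honest A u → Honest B u → u ≡ noiseless next (length u)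
    honest⇒noiseless []            hA hB = refl
    honest⇒noiseless ((a , b) ∷ u) hA hB = cong₂ _∷_
      (trans (cong₂ _,_ (hA ⊑-refl) (hB ⊑-refl)) (cong (λ v → next A v , next B v) u≡)) u≡
      where u≡ = honest⇒noiseless u (honest-⊑ (Suffix.there ⊑-refl) hA) (honest-⊑ (Suffix.there ⊑-refl) hB)

    -- When both users know both positions, their separate case distinctions agree: equal nodes
    -- advance along one common arc, of a strict ancestor and its descendant the first waits and the
    -- second retreats, and incomparable nodes both retreat.
    mark-good : ∀ {t k} u v → Mark t k u v →
      Mark (suc t) k (move (response A u v (next B v)) u) (move (response B v u (next A u)) v)
    mark-good u v mk with u ≟ᴺ v | v ≟ᴺ u | u ⊑? v | v ⊑? u
    ... | yes refl | yes _   | _       | _       = mark-advance (next A u , next B u) u mk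
    ... | yes u≡v  | no v≢u  | _       | _       = contradiction (sym u≡v) v≢u
    ... | no u≢v   | yes v≡u | _       | _       = contradiction (sym v≡u) u≢v
    ... | no u≢v   | no _    | yes u⊑v | yes v⊑u = contradiction (⊑-antisym u⊑v v⊑u) u≢v
      where
      ⊑-antisym : ∀ {u v} → u ⊑ v → v ⊑ u → u ≡ v
      ⊑-antisym p q = Pointwise-≡⇒≡ (Suffix.antisym (λ x≡y _ → x≡y) p q)
    ... | no _     | no _    | yes u⊑v | no v⋢u  = mark-wait u⊑v v⋢u mk
    ... | no _     | no _    | no u⋢v  | yes v⊑u = mark-sym v (parent u) (mark-wait v⊑u u⋢v (mark-sym u v mk))
    ... | no _     | no _    | no u⋢v  | no v⋢u  = mark-retreat u⋢v v⋢u mk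

    -- The label of the current state has not been sent yet.
    path : Party → ∀ {t} → Vec (Fin q) t → Vec Arc t
    path i Z = tail (state (local i Z))

    -- A round that both users decode wrongly counts twice. `mark-bad` needs one unit for it, and a
    -- larger count only weakens the mark.
    failures : ∀ {t} → Vec (Fin q) t → Vec (Fin q) t → ℕ
    failures ZA ZB = wrongs ZA (path B ZB) + wrongs ZB (path A ZA)

    wrongs-path : ∀ j {t} a b (Z Z′ : Vec (Fin q) t) →
      wrongs (a ∷ Z) (path j (b ∷ Z′)) ≡ wrong (a ∷ Z) (state (local j Z′)) + wrongs Z (path j Z′)
    wrongs-path j a b Z Z′ = cong (λ Q → wrong (a ∷ Z) Q + wrongs Z (tail Q)) (tail-state-∷ j b Z′)

    moveOf-correct : ∀ i j {t} z (Z Z′ : Vec (Fin q) t) → decode (z ∷ Z) ≡ state (local j Z′) →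
      let v = position (local j Z′) in
      moveOf i (z ∷ Z) ≡ response i (position (local i Z)) v (next j v)
    moveOf-correct i j z Z Z′ eq = trans (cong (follow i (position (local i Z))) eq)
      (cong₂ (response i (position (local i Z))) (pebble-state j Z′) (bit-state j Z′))

    mark-mono : ∀ {t k k′ u v} → k ≤ k′ → Mark t k u v → Mark t k′ u v
    mark-mono {u = u} {v} k≤k′ (mark l r) = mark (≤-trans l le) (≤-trans r le)
      where le = +-monoʳ-≤ (2 * length (lca u v)) (*-monoʳ-≤ 4 k≤k′)

    mark-local : ∀ {t} (ZA ZB : Vec (Fin q) t) →
      Mark t (failures ZA ZB) (position (local A ZA)) (position (local B ZB))
    mark-local [] [] = mark z≤n z≤n
    mark-local {suc t} (a ∷ ZA) (b ∷ ZB)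
      rewrite position-∷ A a ZA | position-∷ B b ZB
            | wrongs-path B a b ZA ZB | wrongs-path A b a ZB ZA
      with mark-local ZA ZB | decode (a ∷ ZA) ≟ⱽ state (local B ZB) | decode (b ∷ ZB) ≟ⱽ state (local A ZA)
    ... | mk | yes eqA | yes eqB
      rewrite moveOf-correct A B a ZA ZB eqA | moveOf-correct B A b ZB ZA eqB =
      mark-good (position (local A ZA)) (position (local B ZB)) mk
    ... | mk | no _ | _ = mark-mono (+-monoʳ-≤ (suc (wrongs ZA (path B ZB))) (m≤n+m _ _)) (mark-bad (moveOf A (a ∷ ZA)) (moveOf B (b ∷ ZB)) (position (local A ZA)) (position (local B ZB)) mk)
    ... | mk | yes _ | no _ = mark-mono (≤-reflexive (sym (+-suc _ _))) (mark-bad (moveOf A (a ∷ ZA)) (moveOf B (b ∷ ZB)) u v mk)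
      where
      u = position (local A ZA)
      v = position (local B ZB)

    -- Since the least common ancestor is always on the noiseless path, only its depth can make the
    -- simulation fail.
    failure⇒wrongs : ∀ T (ZA ZB : Vec (Fin q) (10 * T)) → ¬ Success T (local A ZA , local B ZB) →
      9 * T ≤ 4 * failures ZA ZB
    failure⇒wrongs T ZA ZB fail = +-cancelˡ-≤ T (9 * T) (4 * k) (begin
      T + 9 * T               ≤⟨ mark-depth {u = u} {v} (mark-local ZA ZB) ⟩
      length (lca u v) + 4 * k  ≤⟨ +-monoˡ-≤ (4 * k) (<⇒≤ (≰⇒> λ T≤ → fail (T≤ , on-path))) ⟩
      T + 4 * k               ∎)
      where
      open ≤-Reasoning
      k = failures ZA ZB
      u = position (local A ZA)
      v = position (local B ZB)
      on-path : lca u v ≡ noiseless next (length (lca u v))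
      on-path = honest⇒noiseless (lca u v)
        (honest-⊑ (lca-⊑ˡ u v) (honest-local A ZA)) (honest-⊑ (lca-⊑ʳ u v) (honest-local B ZB))

open Pebbles

-- The probability of success

module Expectation {c ℓ₁ ℓ₂} (ℛ : Reals c ℓ₁ ℓ₂) where
  open Reals ℛ
  open Probability ℛ
  open RealProperties ℛ

  𝔼 : ∀ {X} → (X → Carrier) → Dist X → Carrier
  𝔼 f []            = 0#
  𝔼 f ((p , x) ∷ d) = p * f x + 𝔼 f d

  𝟙 : ∀ {X : Set} {a} {P : Pred X a} → Decidable P → X → Carrier
  𝟙 P? x with does (P? x)
  ... | true  = 1#
  ... | false = 0#

  𝟙-nonneg : ∀ {X : Set} {a} {P : Pred X a} (P? : Decidable P) x → 0# ≤ 𝟙 P? x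
  𝟙-nonneg P? x with does (P? x)
  ... | true  = 0≤1
  ... | false = ≤-refl

  𝟙-true : ∀ {X : Set} {a} {P : Pred X a} (P? : Decidable P) {x} → P x → 𝟙 P? x ≡ 1#
  𝟙-true P? {x} px with P? x
  ... | yes _  = ≡.refl
  ... | no ¬px = contradiction px ¬px

  Pr≈𝔼 : ∀ {X : Set} {a} {P : Pred X a} (P? : Decidable P) d → Pr P? d ≈ 𝔼 (𝟙 P?) d
  Pr≈𝔼 P? []            = refl
  Pr≈𝔼 P? ((p , x) ∷ d) with does (P? x)
  ... | true  = +-cong (sym (*-identityʳ p)) (Pr≈𝔼 P? d)
  ... | false = trans (Pr≈𝔼 P? d) (trans (sym (+-identityˡ _)) (+-congʳ (sym (zeroʳ p))))

  𝔼-cong : ∀ {X} {f g : X → Carrier} → (∀ x → f x ≈ g x) → ∀ d → 𝔼 f d ≈ 𝔼 g d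
  𝔼-cong f≈g []            = refl
  𝔼-cong f≈g ((p , x) ∷ d) = +-cong (*-congˡ (f≈g x)) (𝔼-cong f≈g d)

  𝔼-mono : ∀ {X} {f g : X → Carrier} {d} → All ((0# ≤_) ∘ proj₁) d →
    (∀ x → f x ≤ g x) → 𝔼 f d ≤ 𝔼 g d
  𝔼-mono []         f≤g = ≤-refl
  𝔼-mono (0≤p ∷ ps) f≤g = +-mono-≤ (*-monoʳ-≤ 0≤p (f≤g _)) (𝔼-mono ps f≤g)

  𝔼-nonneg : ∀ {X} {f : X → Carrier} {d} → All ((0# ≤_) ∘ proj₁) d → (∀ x → 0# ≤ f x) → 0# ≤ 𝔼 f d
  𝔼-nonneg []         0≤f = ≤-refl
  𝔼-nonneg (0≤p ∷ ps) 0≤f = +-nonneg (*-nonneg 0≤p (0≤f _)) (𝔼-nonneg ps 0≤f)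

  𝔼-+ : ∀ {X} (f g : X → Carrier) d → 𝔼 (λ x → f x + g x) d ≈ 𝔼 f d + 𝔼 g d
  𝔼-+ f g []            = sym (+-identityˡ 0#)
  𝔼-+ f g ((p , x) ∷ d) = trans (+-congˡ (𝔼-+ f g d))
    (solve 5 (λ p a b u v → p :* (a :+ b) :+ (u :+ v) ⊜ p :* a :+ u :+ (p :* b :+ v)) refl p (f x) (g x) _ _)

  𝔼-*ˡ : ∀ {X} k (f : X → Carrier) d → 𝔼 (λ x → k * f x) d ≈ k * 𝔼 f d
  𝔼-*ˡ k f []            = sym (zeroʳ k)
  𝔼-*ˡ k f ((p , x) ∷ d) = trans (+-congˡ (𝔼-*ˡ k f d))
    (solve 4 (λ p k a u → p :* (k :* a) :+ k :* u ⊜ k :* (p :* a :+ u)) refl p k (f x) _)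

  𝔼-*ʳ : ∀ {X} k (f : X → Carrier) d → 𝔼 (λ x → f x * k) d ≈ 𝔼 f d * k
  𝔼-*ʳ k f d = trans (𝔼-cong (λ x → *-comm (f x) k) d) (trans (𝔼-*ˡ k f d) (*-comm k _))

  𝔼-++ : ∀ {X} (f : X → Carrier) d e → 𝔼 f (d ++ e) ≈ 𝔼 f d + 𝔼 f e
  𝔼-++ f []            e = sym (+-identityˡ _)
  𝔼-++ f ((p , x) ∷ d) e = trans (+-congˡ (𝔼-++ f d e)) (sym (+-assoc _ _ _))

  𝔼-scale : ∀ {X} (f : X → Carrier) p d → 𝔼 f (map (λ (r , y) → (p * r , y)) d) ≈ p * 𝔼 f d
  𝔼-scale f p []            = sym (zeroʳ p)
  𝔼-scale f p ((r , y) ∷ d) = trans (+-congˡ (𝔼-scale f p d))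
    (solve 4 (λ p r a u → p :* r :* a :+ p :* u ⊜ p :* (r :* a :+ u)) refl p r (f y) _)

  𝔼->>= : ∀ {X Y} (f : Y → Carrier) d (g : X → Dist Y) → 𝔼 f (d >>= g) ≈ 𝔼 (𝔼 f ∘ g) d
  𝔼->>= f []            g = refl
  𝔼->>= f ((p , x) ∷ d) g = trans (𝔼-++ f (map (λ (r , y) → (p * r , y)) (g x)) (d >>= g)) (+-cong (𝔼-scale f p (g x)) (𝔼->>= f d g))

  𝔼-return : ∀ {X} (f : X → Carrier) x → 𝔼 f (return x) ≈ f x
  𝔼-return f x = trans (+-identityʳ _) (*-identityˡ (f x))

  module _ {q} {K : Channel q} (isChannel : IsChannel K) where
    open IsChannel isChannel

    transmit-nonneg : ∀ s → All ((0# ≤_) ∘ proj₁) (transmit K s)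
    transmit-nonneg s = All.map⁺ (universal (nonneg s) (allFin q))

    𝔼-transmit-1 : ∀ s → 𝔼 (λ _ → 1#) (transmit K s) ≈ 1#
    𝔼-transmit-1 s = trans (mass (allFin q)) (total s)
      where
      mass : ∀ rs → 𝔼 (λ _ → 1#) (map (λ r → (K s r , r)) rs) ≈ foldr _+_ 0# (map (K s) rs)
      mass []       = refl
      mass (r ∷ rs) = +-cong (*-identityʳ _) (mass rs)

    -- `p` bounds a probability from above; the label `s` is there to provide such a probability.
    0≤error : ∀ {p} → ErrorAtMost p K → Fin q → 0# ≤ p
    0≤error error s = ≤-trans (𝔼-nonneg (transmit-nonneg s) (𝟙-nonneg {P = _≢ s} (λ r → ¬? (r Fin.≟ s))))
      (≤-trans (≤-reflexive (sym (Pr≈𝔼 _ (transmit K s)))) (error s))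

    -- The weight of one label is 1 if it is correct and z if it is not, so at most 1 plus z times
    -- the indicator of an error.
    𝔼-transmit-^δ : ∀ {p z} → 0# ≤ z → ErrorAtMost p K → ∀ s →
      𝔼 (λ r → z ^ δ r s) (transmit K s) ≤ 1# + z * p
    𝔼-transmit-^δ {p} {z} 0≤z error s = begin
      𝔼 (λ r → z ^ δ r s) (transmit K s)            ≤⟨ 𝔼-mono (transmit-nonneg s) pointwise ⟩
      𝔼 (λ r → 1# + z * err r) (transmit K s)       ≈⟨ 𝔼-+ _ _ (transmit K s) ⟩
      𝔼 (λ _ → 1#) (transmit K s) + 𝔼 (λ r → z * err r) (transmit K s)
        ≈⟨ +-cong (𝔼-transmit-1 s) (𝔼-*ˡ z err (transmit K s)) ⟩
      1# + z * 𝔼 err (transmit K s)                 ≈⟨ +-congˡ (*-congˡ (Pr≈𝔼 _ (transmit K s))) ⟨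
      1# + z * Pr (λ r → ¬? (r Fin.≟ s)) (transmit K s)  ≤⟨ +-mono-≤ ≤-refl (*-monoʳ-≤ 0≤z (error s)) ⟩
      1# + z * p                                    ∎
      where
      open ≤-Reasoning
      err = 𝟙 (λ r → ¬? (r Fin.≟ s))
      pointwise : ∀ r → z ^ δ r s ≤ 1# + z * err r
      pointwise r with r Fin.≟ s
      ... | yes _ = x≤x+y (*-nonneg 0≤z ≤-refl)
      ... | no  _ = y≤x+y 0≤1

-- The simulation as a Markov chain

module Simulation {c ℓ₁ ℓ₂} (ℛ : Reals c ℓ₁ ℓ₂) {q} (w : TreeCode q)
    (decode : ∀ {t} → Vec (Fin q) t → Vec Arc t) (next : Party → Node → Bool) where
  open Reals ℛ
  open Probability ℛ
  open RealProperties ℛ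
  open Expectation ℛ
  open Sim w decode next
  open Decoding w decode
  open Analysis w decode next

  errors : ∀ {t} → Vec (Fin q) t → Vec (Fin q) t → ℕ
  errors ZA ZB = hamming ZA (W w (path B ZB)) ℕ.+ hamming ZB (W w (path A ZA))

  W-∷ : ∀ {t} (s : Vec Arc (suc t)) → W w s ≡ w s ∷ W w (tail s)
  W-∷ (a ∷ s) = ≡.refl

  hamming-path : ∀ j {t} a b (Z Z′ : Vec (Fin q) t) →
    hamming (a ∷ Z) (W w (path j (b ∷ Z′))) ≡ δ a (outgoing (local j Z′)) ℕ.+ hamming Z (W w (path j Z′))
  hamming-path j a b Z Z′ = ≡.trans
    (cong (hamming (a ∷ Z)) (≡.trans (cong (W w) (tail-state-∷ j b Z′)) (W-∷ (state (local j Z′)))))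
    (hamming-∷ a _ Z _)

  -- The labels cross over: `a`, sent by A, joins the labels received by B. The summands follow the
  -- nesting of the expectations in `round`, with `a` outside `b`.
  errors-∷ : ∀ {t} a b (ZA ZB : Vec (Fin q) t) → errors (b ∷ ZA) (a ∷ ZB) ≡
    δ a (outgoing (local A ZA)) ℕ.+ (δ b (outgoing (local B ZB)) ℕ.+ errors ZA ZB)
  errors-∷ a b ZA ZB = ≡.trans (cong₂ ℕ._+_ (hamming-path B b a ZA ZB) (hamming-path A a b ZB ZA))
    (shuffle (δ b (outgoing (local B ZB))) (hamming ZA (W w (path B ZB))) (δ a (outgoing (local A ZA))) (hamming ZB (W w (path A ZA))))
    where
    shuffle : ∀ x e y f → x ℕ.+ e ℕ.+ (y ℕ.+ f) ≡ y ℕ.+ (x ℕ.+ (e ℕ.+ f))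
    shuffle = solve-∀

  -- Of the 9αT that a failure requires, the bad subpaths absorb 4αT for each user; errors must
  -- supply the remaining αT, at 8 per error.
  failure⇒errors : ∀ {α} → 0# ≤ α → ∀ T → IsDecoder (10 ℕ.* T) w decode →
    Potent ℛ (10 ℕ.* T) (recip (0<fromℕ 9)) α w → ∀ ZA ZB →
    ¬ Success T {10 ℕ.* T} (local A ZA , local B ZB) → α * fromℕ T ≤ fromℕ 8 * fromℕ (errors ZA ZB)
  failure⇒errors {α} 0≤α T dec potent ZA ZB fail = +-cancelʳ-≤ (fromℕ 8 * (α * t)) (begin
    α * t + fromℕ 8 * (α * t)             ≈⟨ solve 3 (λ n a t → a :* t :+ n :* (a :* t) ⊜ a :* ((con 1 :+ n) :* t)) refl (fromℕ 8) α t ⟩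
    α * (fromℕ 9 * t)                     ≈⟨ *-congˡ (fromℕ-* 9 T) ⟨
    α * fromℕ (9 ℕ.* T)                   ≤⟨ *-monoʳ-≤ 0≤α (fromℕ-mono-≤ (failure⇒wrongs T ZA ZB fail)) ⟩
    α * fromℕ (4 ℕ.* (kA ℕ.+ kB))         ≈⟨ *-congˡ (trans (fromℕ-* 4 (kA ℕ.+ kB)) (*-congˡ (fromℕ-+ kA kB))) ⟩
    α * (fromℕ 4 * (fromℕ kA + fromℕ kB)) ≈⟨ solve 4 (λ a n x y → a :* (n :* (x :+ y)) ⊜ n :* (a :* x :+ a :* y)) refl α (fromℕ 4) _ _ ⟩
    fromℕ 4 * (α * fromℕ kA + α * fromℕ kB)
      ≤⟨ *-monoʳ-≤ (0≤fromℕ 4) (+-mono-≤ (wrongs-bound T dec potent ZA (path B ZB)) (wrongs-bound T dec potent ZB (path A ZA))) ⟩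
    fromℕ 4 * (α * t + fromℕ 2 * fromℕ eA + (α * t + fromℕ 2 * fromℕ eB))
      ≈⟨ solve 4 (λ n s x y → n :* (s :+ two :* x :+ (s :+ two :* y)) ⊜ n :* two :* (x :+ y) :+ n :* two :* s) refl (fromℕ 4) (α * t) (fromℕ eA) (fromℕ eB) ⟩
    fromℕ 4 * fromℕ 2 * (fromℕ eA + fromℕ eB) + fromℕ 4 * fromℕ 2 * (α * t)
      ≈⟨ +-cong (*-cong (fromℕ-* 4 2) (fromℕ-+ eA eB)) (*-congʳ (fromℕ-* 4 2)) ⟨
    fromℕ 8 * fromℕ (eA ℕ.+ eB) + fromℕ 8 * (α * t)  ∎)
    where
    open ≤-Reasoning
    open Charging ℛ α 0≤α
    t = fromℕ T
    kA = wrongs ZA (path B ZB)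
    kB = wrongs ZB (path A ZA)
    eA = hamming ZA (W w (path B ZB))
    eB = hamming ZB (W w (path A ZA))
    two = con 1 :+ (con 1 :+ con 0)

  module Run (K : Party → Channel q) (isChannel : ∀ i → IsChannel (K i)) where

    -- The transition operator of the chain of configurations, acting on functions.
    round : ∀ {t} → (Config (suc t) → Carrier) → Config t → Carrier
    round f (LA , LB) =
      𝔼 (λ a → 𝔼 (λ b → f (update A LA b , update B LB a)) (transmit (K B) (outgoing LB)))
        (transmit (K A) (outgoing LA))

    𝔼-run-suc : ∀ {t} (f : Config (suc t) → Carrier) → 𝔼 f (run ℛ K (suc t)) ≈ 𝔼 (round f) (run ℛ K t)
    𝔼-run-suc {t} f = trans (𝔼->>= f (run ℛ K t) sendA) (𝔼-cong (λ c@(LA , LB) →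
      trans (𝔼->>= f (transmit (K A) (outgoing LA)) (sendB c)) (𝔼-cong (λ a →
        trans (𝔼->>= f (transmit (K B) (outgoing LB)) (end c a)) (𝔼-cong (λ b →
          𝔼-return f (update A LA b , update B LB a)) (transmit (K B) (outgoing LB)))) (transmit (K A) (outgoing LA)))) (run ℛ K t))
      where
      end : Config t → Fin q → Fin q → Dist (Config (suc t))
      end (LA , LB) a b = return (update A LA b , update B LB a)
      sendB : Config t → Fin q → Dist (Config (suc t))
      sendB c@(LA , LB) a = transmit (K B) (outgoing LB) >>= end c a
      sendA : Config t → Dist (Config (suc t))
      sendA c@(LA , LB) = transmit (K A) (outgoing LA) >>= sendB c

    -- The functions are compared only at configurations determined by received labels: the bounds
    -- on marks and weights rest on invariants that arbitrary pairs of `Local` lack. `round`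
    -- preserves this form because `local` unfolds to `update`.
    𝔼-run-mono : ∀ t {f g : Config t → Carrier} →
      (∀ ZA ZB → f (local A ZA , local B ZB) ≤ g (local A ZA , local B ZB)) →
      𝔼 f (run ℛ K t) ≤ 𝔼 g (run ℛ K t)
    𝔼-run-mono zero    f≤g = +-mono-≤ (*-monoʳ-≤ 0≤1 (f≤g [] [])) ≤-refl
    𝔼-run-mono (suc t) {f} {g} f≤g = begin
      𝔼 f (run ℛ K (suc t))    ≈⟨ 𝔼-run-suc {t} f ⟩
      𝔼 (round f) (run ℛ K t)  ≤⟨ 𝔼-run-mono t (λ ZA ZB →
        𝔼-mono (transmit-nonneg (isChannel A) _) λ a →
        𝔼-mono (transmit-nonneg (isChannel B) _) λ b → f≤g (b ∷ ZA) (a ∷ ZB)) ⟩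
      𝔼 (round g) (run ℛ K t)  ≈⟨ 𝔼-run-suc {t} g ⟨
      𝔼 g (run ℛ K (suc t))    ∎
      where open ≤-Reasoning

    𝔼-run-1 : ∀ t → 𝔼 (λ _ → 1#) (run ℛ K t) ≈ 1#
    𝔼-run-1 zero    = trans (+-identityʳ _) (*-identityʳ 1#)
    𝔼-run-1 (suc t) = trans (𝔼-run-suc {t} (λ _ → 1#)) (trans (𝔼-cong (λ (LA , LB) →
      trans (𝔼-cong (λ _ → 𝔼-transmit-1 (isChannel B) (outgoing LB)) (transmit (K A) (outgoing LA)))
        (𝔼-transmit-1 (isChannel A) (outgoing LA))) (run ℛ K t)) (𝔼-run-1 t))

    module _ {z p} (0≤z : 0# ≤ z) (0≤p : 0# ≤ p) (error : ∀ i → ErrorAtMost p (K i)) where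

      weight : ∀ {t} → Config t → Carrier
      weight (LA , LB) = z ^ errors (received LA) (received LB)

      private
        M = 1# + z * p
        0≤M : 0# ≤ M
        0≤M = +-nonneg 0≤1 (*-nonneg 0≤z 0≤p)

      weight-local : ∀ {t} (ZA ZB : Vec (Fin q) t) → weight (local A ZA , local B ZB) ≡ z ^ errors ZA ZB
      weight-local ZA ZB = cong₂ (λ Z Z′ → z ^ errors Z Z′) (received-local A ZA) (received-local B ZB)

      -- Given the configuration, both outgoing labels are fixed and their transmissions are
      -- independent, so the mean factors. In effect, the weight divided by `M ^ (2 * t)` is a
      -- supermartingale.
      round-weight : ∀ {t} (ZA ZB : Vec (Fin q) t) →
        round weight (local A ZA , local B ZB) ≤ M ^ 2 * weight (local A ZA , local B ZB)
      round-weight ZA ZB = begin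
        round weight (local A ZA , local B ZB)
          ≈⟨ 𝔼-cong (λ a → 𝔼-cong (λ b → split a b) (transmit (K B) sB)) (transmit (K A) sA) ⟩
        𝔼 (λ a → 𝔼 (λ b → z ^ δ a sA * (z ^ δ b sB * E)) (transmit (K B) sB)) (transmit (K A) sA)
          ≈⟨ 𝔼-cong (λ a → trans (𝔼-*ˡ _ _ (transmit (K B) sB)) (*-congˡ (𝔼-*ʳ E _ (transmit (K B) sB)))) (transmit (K A) sA) ⟩
        𝔼 (λ a → z ^ δ a sA * (𝔼 (λ b → z ^ δ b sB) (transmit (K B) sB) * E)) (transmit (K A) sA)
          ≈⟨ 𝔼-*ʳ _ _ (transmit (K A) sA) ⟩
        𝔼 (λ a → z ^ δ a sA) (transmit (K A) sA) * (𝔼 (λ b → z ^ δ b sB) (transmit (K B) sB) * E)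
          ≤⟨ *-mono-≤ (0≤δ A sA) (*-nonneg 0≤M 0≤E) (𝔼-transmit-^δ (isChannel A) 0≤z (error A) sA)
               (*-mono-≤ (0≤δ B sB) 0≤E (𝔼-transmit-^δ (isChannel B) 0≤z (error B) sB) ≤-refl) ⟩
        M * (M * E)
          ≈⟨ solve 2 (λ m e → m :* (m :* e) ⊜ m :* (m :* con 1) :* e) refl M E ⟩
        M ^ 2 * E
          ≡⟨ cong (M ^ 2 *_) (weight-local ZA ZB) ⟨
        M ^ 2 * weight (local A ZA , local B ZB)  ∎
        where
        open ≤-Reasoning
        sA = outgoing (local A ZA)
        sB = outgoing (local B ZB)
        E = z ^ errors ZA ZB
        0≤E = ^-nonneg (errors ZA ZB) 0≤z
        split : ∀ a b → weight (local A (b ∷ ZA) , local B (a ∷ ZB)) ≈ z ^ δ a sA * (z ^ δ b sB * E)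
        split a b = begin-equality
          weight (local A (b ∷ ZA) , local B (a ∷ ZB))   ≡⟨ weight-local (b ∷ ZA) (a ∷ ZB) ⟩
          z ^ errors (b ∷ ZA) (a ∷ ZB)                   ≡⟨ cong (z ^_) (errors-∷ a b ZA ZB) ⟩
          z ^ (δ a sA ℕ.+ (δ b sB ℕ.+ errors ZA ZB))     ≈⟨ ^-homo-* z (δ a sA) _ ⟩
          z ^ δ a sA * z ^ (δ b sB ℕ.+ errors ZA ZB)     ≈⟨ *-congˡ (^-homo-* z (δ b sB) _) ⟩
          z ^ δ a sA * (z ^ δ b sB * E)                  ∎
        0≤δ : ∀ i s → 0# ≤ 𝔼 (λ r → z ^ δ r s) (transmit (K i) s)
        0≤δ i s = 𝔼-nonneg (transmit-nonneg (isChannel i) s) (λ r → ^-nonneg (δ r s) 0≤z)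

      𝔼-weight : ∀ t → 𝔼 weight (run ℛ K t) ≤ M ^ (2 ℕ.* t)
      𝔼-weight zero    = ≤-reflexive (trans (+-identityʳ _) (*-identityʳ 1#))
      𝔼-weight (suc t) = begin
        𝔼 weight (run ℛ K (suc t))        ≈⟨ 𝔼-run-suc {t} weight ⟩
        𝔼 (round weight) (run ℛ K t)      ≤⟨ 𝔼-run-mono t round-weight ⟩
        𝔼 (λ c → M ^ 2 * weight c) (run ℛ K t)  ≈⟨ 𝔼-*ˡ (M ^ 2) weight (run ℛ K t) ⟩
        M ^ 2 * 𝔼 weight (run ℛ K t)      ≤⟨ *-monoʳ-≤ (^-nonneg 2 0≤M) (𝔼-weight t) ⟩
        M ^ 2 * M ^ (2 ℕ.* t)             ≈⟨ ^-homo-* M 2 (2 ℕ.* t) ⟨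
        M ^ (2 ℕ.+ 2 ℕ.* t)               ≡⟨ cong (M ^_) (ℕ.*-suc 2 t) ⟨
        M ^ (2 ℕ.* suc t)                 ∎
        where open ≤-Reasoning

  -- Markov's inequality in pointwise form: in each execution, the indicator of success plus the
  -- weight divided by 4 ^ T is at least 1.
  success-probability : ∀ {α} (0<α : 0# < α) → α < 1# → ∀ T →
    Potent ℛ (10 ℕ.* T) (recip (0<fromℕ 9)) α w → IsDecoder (10 ℕ.* T) w decode →
    ∀ p (K : Party → Channel q) → p < exp₂ (- (fromℕ 42 * recip 0<α)) →
    (∀ i → IsChannel (K i)) → (∀ i → ErrorAtMost p (K i)) →
    1# - exp₂ (- (1# * fromℕ T)) ≤ Pr (success? T) (run ℛ K (10 ℕ.* T))
  success-probability {α} 0<α α<1 T potent dec p K p< isChannel error = x-y≤z (begin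
    1#                                          ≈⟨ 𝔼-run-1 N ⟨
    𝔼 (λ _ → 1#) (run ℛ K N)                    ≤⟨ 𝔼-run-mono N pointwise ⟩
    𝔼 (λ c → 𝟙 (success? T) c + weight′ c * s) (run ℛ K N)  ≈⟨ 𝔼-+ _ _ (run ℛ K N) ⟩
    𝔼 (𝟙 (success? T)) (run ℛ K N) + 𝔼 (λ c → weight′ c * s) (run ℛ K N)
      ≈⟨ +-cong (sym (Pr≈𝔼 (success? T) (run ℛ K N))) (𝔼-*ʳ s weight′ (run ℛ K N)) ⟩
    Pr (success? T) (run ℛ K N) + 𝔼 weight′ (run ℛ K N) * s
      ≤⟨ +-mono-≤ ≤-refl (*-monoˡ-≤ (exp₂-nonneg _) (𝔼-weight 0≤z 0≤p error N)) ⟩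
    Pr (success? T) (run ℛ K N) + (1# + z * p) ^ (2 ℕ.* (10 ℕ.* T)) * s
      ≡⟨ cong (λ n → Pr (success? T) (run ℛ K N) + (1# + z * p) ^ n * s) (ℕ.*-assoc 2 10 T) ⟨
    Pr (success? T) (run ℛ K N) + (1# + z * p) ^ (20 ℕ.* T) * s
      ≤⟨ +-mono-≤ ≤-refl (mean-weight-bound T 0≤p (<⇒≤ p<)) ⟩
    Pr (success? T) (run ℛ K N) + exp₂ (- (1# * fromℕ T))  ∎)
    where
    open ≤-Reasoning
    open ErrorWeight 0<α α<1
    open Run K isChannel
    N = 10 ℕ.* T
    s = exp₂ (- (fromℕ 2 * fromℕ T))
    -- The first label that A would send shows that the alphabet is inhabited, even when T is 0.
    0≤p : 0# ≤ p
    0≤p = 0≤error (isChannel A) (error A) (outgoing (local A []))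
    weight′ : ∀ {t} → Config t → Carrier
    weight′ = weight 0≤z 0≤p error
    pointwise : ∀ ZA ZB → 1# ≤ 𝟙 (success? T) (local A ZA , local B ZB) + weight′ (local A ZA , local B ZB) * s
    pointwise ZA ZB = case success? T {N} cfg of λ where
        (yes ok)  → ≤-trans (≤-reflexive (≡⇒≈ (≡.sym (𝟙-true (success? T) {cfg} ok))))
          (x≤x+y (*-nonneg (^-nonneg (errors (received (local A ZA)) (received (local B ZB))) 0≤z) (exp₂-nonneg _)))
        (no fail) → ≤-trans (4^T≤z^e T (errors ZA ZB) (failure⇒errors (<⇒≤ 0<α) T dec potent ZA ZB fail))
          (≤-trans (≤-reflexive (*-congʳ (≡⇒≈ (≡.sym (weight-local 0≤z 0≤p error ZA ZB)))))
            (y≤x+y (𝟙-nonneg (success? T) cfg)))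
      where
      cfg : Config N
      cfg = local A ZA , local B ZB
      ≡⇒≈ : ∀ {x y : Carrier} → x ≡ y → x ≈ y
      ≡⇒≈ ≡.refl = refl

-- The program of a user

module Programs where
  open import Data.Nat using (_+_; _*_; _≤_; _<_)
  open import Data.Nat.Properties
  open ≡ using (refl; sym; trans)

  -- The variables are: 0 the remaining rounds, 1 the position, 2 the state,
  -- 3 the labels received, 4 scratch (a label, the decoded state, a bit),
  -- 5 and 9 reversed lists, 6 the decoded position, 7 the decoded bit,
  -- 8 the move.

  truth : Expr 10
  truth = cons nil nil

  move-onto : Fin 10 → Fin 10 → Cmd Oracle 10
  move-onto x y = while var x loop (y := cons (hd (var x)) (var y) ⨟ x := tl (var x))

  -- Replays the decoded moves from the root. The encodings of `H`, `B` and `to m` are told apart as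
  -- nil, as a pair with nil head, and as a pair with non-nil head. `tl` of nil is nil, in
  -- accordance with `parent []`.
  walk : Cmd Oracle 10
  walk = while var 5F loop
    ( 8F := hd (hd (var 5F))
    ⨟ (if var 8F then (if hd (var 8F) then (6F := cons (tl (var 8F)) (var 6F)) else (6F := tl (var 6F))) else skip)
    ⨟ 8F := nil
    ⨟ 5F := tl (var 5F))

  differ : Expr 10 → Expr 10 → Cmd Oracle 10
  differ e f = if e then (if f then skip else (8F := truth)) else (if f then (8F := truth) else skip)

  -- Once both nodes are listed from the root, being an ancestor means being a prefix. Variable 8
  -- records a mismatch; otherwise the remainder in variable 5 tells a strict ancestor from
  -- equality.
  compare : Cmd Oracle 10
  compare = while var 9F loop
    ( (if var 5F then (differ (hd (hd (var 9F))) (hd (hd (var 5F))) ⨟ differ (tl (hd (var 9F))) (tl (hd (var 5F)))) else (8F := truth))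
    ⨟ 9F := tl (var 9F)
    ⨟ 5F := tl (var 5F))

  pair : Party → Expr 10 → Expr 10 → Expr 10
  pair A e f = cons e f
  pair B e f = cons f e

  -- The flag left in variable 8 by the comparison already is the encoding of
  -- the move B or H.
  react : Party → Cmd Oracle 10
  react i = if var 8F then (1F := tl (var 1F)) else
    (if var 5F then skip else
      ( 4F :=query protocol [ var 1F ]
      ⨟ 8F := cons truth (pair i (var 4F) (var 7F))
      ⨟ 1F := cons (tl (var 8F)) (var 1F)))

  communicate : Cmd Oracle 10
  communicate =
      0F := tl (var 0F)
    ⨟ 4F :=query label [ var 2F ]
    ⨟ send (var 4F)
    ⨟ receive 4F
    ⨟ 3F := cons (var 4F) (var 3F)

  infer : Cmd Oracle 10
  infer =
      4F :=query decoding [ var 3F ]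
    ⨟ 7F := tl (hd (var 4F))
    ⨟ move-onto 4F 5F
    ⨟ walk

  align : Cmd Oracle 10
  align =
      4F := var 1F
    ⨟ move-onto 4F 9F
    ⨟ move-onto 6F 5F
    ⨟ compare

  record-state : Cmd Oracle 10
  record-state =
      4F :=query protocol [ var 1F ]
    ⨟ 2F := cons (cons (var 8F) (var 4F)) (var 2F)
    ⨟ 4F := nil
    ⨟ 5F := nil
    ⨟ 7F := nil
    ⨟ 8F := nil

  round-cmd : Party → Cmd Oracle 10
  round-cmd i = communicate ⨟ infer ⨟ align ⨟ react i ⨟ record-state

  initialise : Cmd Oracle 10
  initialise =
      4F :=query protocol [ var 1F ]
    ⨟ 2F := cons (cons nil (var 4F)) nil
    ⨟ 4F := nil

  program : Party → Program
  program i = record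
    { extra = 9
    ; body  = initialise ⨟ (while var 0F loop round-cmd i) ⨟ 0F := var 1F
    }

  -- Sizes of encodings

  size-encℕ : ∀ n → size (encℕ n) ≡ suc (2 * n)
  size-encℕ zero    = refl
  size-encℕ (suc n) = cong (λ x → suc (suc x)) (trans (size-encℕ n) (sym (+-suc n (n + 0))))

  size-encBool : ∀ b → size (encBool b) ≤ 3
  size-encBool false = s≤s z≤n
  size-encBool true  = ≤-refl

  size-encMsg : ∀ m → size (encMsg m) ≤ 7
  size-encMsg (a , b) = s≤s (+-mono-≤ (size-encBool a) (size-encBool b))

  size-encMove : ∀ m → size (encMove m) ≤ 11
  size-encMove H      = s≤s z≤n
  size-encMove B      = s≤s (s≤s (s≤s z≤n))
  size-encMove (to m) = +-monoʳ-≤ 4 (size-encMsg m)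

  size-encArc : ∀ a → size (encArc a) ≤ 15
  size-encArc (m , b) = s≤s (+-mono-≤ (size-encMove m) (size-encBool b))

  size-encList : ∀ {X : Set} {enc : X → Tree} {k} → (∀ x → size (enc x) ≤ k) →
    ∀ xs → size (encList enc xs) ≤ suc (length xs * suc k)
  size-encList size≤ []       = ≤-refl
  size-encList {k = k} size≤ (x ∷ xs) = s≤s (≤-trans (+-mono-≤ (size≤ x) (size-encList size≤ xs))
    (≤-reflexive (+-suc k _)))

  length-toList : ∀ {X : Set} {t} (xs : Vec X t) → length (toList xs) ≡ t
  length-toList []       = refl
  length-toList (x ∷ xs) = cong suc (length-toList xs)

  -- What the loops compute

  differs : Bool → Bool → Bool → Bool
  differs f a b with a xor b
  ... | true  = true
  ... | false = f

  differs-msg : Bool → Msg → Msg → Bool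
  differs-msg f (a , b) (c , d) = differs (differs f a c) b d

  strip : Bool → Node → Node → Bool × Node
  strip f []      y       = f , y
  strip f (m ∷ u) []      = strip true u []
  strip f (m ∷ u) (n ∷ y) = strip (differs-msg f m n) u y

  strip-true : ∀ u y → proj₁ (strip true u y) ≡ true
  strip-true []            y             = refl
  strip-true (m ∷ u)       []            = strip-true u []
  strip-true ((a , b) ∷ u) ((c , d) ∷ y) = trans (cong (λ f → proj₁ (strip f u y)) (still a b c d)) (strip-true u y)
    where
    always : ∀ a b → differs true a b ≡ true
    always a b with a xor b
    ... | true  = refl
    ... | false = refl
    still : ∀ a b c d → differs-msg true (a , b) (c , d) ≡ true
    still a b c d = trans (cong (λ f → differs f b d) (always a c)) (always b d)

  differs-msg-spec : ∀ m n → (m ≡ n × differs-msg false m n ≡ false) ⊎ (m ≢ n × differs-msg false m n ≡ true)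
  differs-msg-spec (true  , true ) (true  , true ) = inj₁ (refl , refl)
  differs-msg-spec (true  , false) (true  , false) = inj₁ (refl , refl)
  differs-msg-spec (false , true ) (false , true ) = inj₁ (refl , refl)
  differs-msg-spec (false , false) (false , false) = inj₁ (refl , refl)
  differs-msg-spec (true  , true ) (true  , false) = inj₂ ((λ ()) , refl)
  differs-msg-spec (true  , true ) (false , true ) = inj₂ ((λ ()) , refl)
  differs-msg-spec (true  , true ) (false , false) = inj₂ ((λ ()) , refl)
  differs-msg-spec (true  , false) (true  , true ) = inj₂ ((λ ()) , refl)
  differs-msg-spec (true  , false) (false , true ) = inj₂ ((λ ()) , refl)
  differs-msg-spec (true  , false) (false , false) = inj₂ ((λ ()) , refl)
  differs-msg-spec (false , true ) (true  , true ) = inj₂ ((λ ()) , refl)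
  differs-msg-spec (false , true ) (true  , false) = inj₂ ((λ ()) , refl)
  differs-msg-spec (false , true ) (false , false) = inj₂ ((λ ()) , refl)
  differs-msg-spec (false , false) (true  , true ) = inj₂ ((λ ()) , refl)
  differs-msg-spec (false , false) (true  , false) = inj₂ ((λ ()) , refl)
  differs-msg-spec (false , false) (false , true ) = inj₂ ((λ ()) , refl)

  -- After a mismatch the remainder is unconstrained, as the program then consults only the flag.
  data Stripped (u y : Node) : Bool × Node → Set where
    prefix   : ∀ {z} → y ≡ u ++ z → Stripped u y (false , z)
    mismatch : ∀ {z} → (∀ z′ → y ≢ u ++ z′) → Stripped u y (true , z)

  stripped-true : ∀ {u y} r → proj₁ r ≡ true → (∀ z′ → y ≢ u ++ z′) → Stripped u y r
  stripped-true (true , z) refl none = mismatch none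

  strip-spec : ∀ u y → Stripped u y (strip false u y)
  strip-spec []      y       = prefix refl
  strip-spec (m ∷ u) []      = stripped-true (strip true u []) (strip-true u []) (λ _ ())
  strip-spec (m ∷ u) (n ∷ y) with differs-msg false m n | differs-msg-spec m n
  ... | _ | inj₂ (m≢n , refl)  = stripped-true (strip true u y) (strip-true u y) (λ _ eq → m≢n (sym (List.∷-injectiveˡ eq)))
  ... | _ | inj₁ (refl , refl) with strip false u y | strip-spec u y
  ...   | _ | prefix y≡      = prefix (cong (m ∷_) y≡)
  ...   | _ | mismatch none  = mismatch (λ z′ → none z′ ∘ List.∷-injectiveʳ)

  reverse-++⇒ : ∀ (v y z : Node) → reverse y ≡ reverse v ++ z → y ≡ reverse z ++ v
  reverse-++⇒ v y z eq = begin
    y                              ≡⟨ List.reverse-involutive y ⟨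
    reverse (reverse y)            ≡⟨ cong reverse eq ⟩
    reverse (reverse v ++ z)       ≡⟨ List.reverse-++ (reverse v) z ⟩
    reverse z ++ reverse (reverse v) ≡⟨ cong (reverse z ++_) (List.reverse-involutive v) ⟩
    reverse z ++ v                 ∎
    where open ≡.≡-Reasoning

  ⊑⇒reverse-++ : ∀ {v y} → v ⊑ y → ∃[ z ] reverse y ≡ reverse v ++ z
  ⊑⇒reverse-++ {v} {y} v⊑y with Suffix.toView v⊑y
  ... | cs Suffix.++ v≡ = reverse cs , trans (List.reverse-++ cs _) (cong (λ x → reverse x ++ reverse cs) (sym (Pointwise-≡⇒≡ v≡)))

  -- The accumulating form of `pebble`, taking the moves from the root as `walk` does.
  walked : List Arc → Node → Node
  walked []             y = y
  walked ((m , _) ∷ as) y = walked as (move m y)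

  walked-reverse : ∀ {t} (s : Vec Arc t) as → walked (toList s ʳ++ as) [] ≡ walked as (pebble s)
  walked-reverse []      as = refl
  walked-reverse (a ∷ s) as = walked-reverse s (a ∷ as)

  length-pebble : ∀ {t} (s : Vec Arc t) → length (pebble s) ≤ t
  length-pebble []            = z≤n
  length-pebble ((m , _) ∷ s) = ≤-trans (length-move m (pebble s)) (s≤s (length-pebble s))

  -- Running times

  module Timed (Answer : Oracle → Tree → Tree → Set) (S : ℕ) (1≤S : 1 ≤ S) where
    open Semantics Answer {10}

    -- The unit of time is `S`, chosen above the size of all data exchanged. An elementary command
    -- then costs a small constant, and costs add up in `k` alone.
    record Runs (c : Cmd Oracle 10) (σ : Store 10) (es : List Event) (k : ℕ) (σ′ : Store 10) : Set where
      constructor runs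
      field
        {steps} : ℕ
        exec    : Exec c σ es steps σ′
        steps≤  : steps ≤ k * S

    infixr 3 _then_
    _then_ : ∀ {c c′ σ σ′ σ″ es es′ k k′} → Runs c σ es k σ′ → Runs c′ σ′ es′ k′ σ″ →
      Runs (c ⨟ c′) σ (es ++ es′) (k + k′) σ″
    _then_ {k = k} {k′} (runs e l) (runs e′ l′) =
      runs (seq e e′) (≤-trans (+-mono-≤ l l′) (≤-reflexive (sym (*-distribʳ-+ S k k′))))

    constant : ∀ {n} k → n ≤ k → n ≤ k * S
    constant k n≤k = ≤-trans n≤k (≤-trans (≤-reflexive (sym (*-identityʳ k))) (*-monoʳ-≤ k 1≤S))

    runs-skip : ∀ {σ} → Runs skip σ [] 1 σ
    runs-skip = runs skip (constant 1 ≤-refl)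

    runs-assign : ∀ {σ x e} → Runs (x := e) σ [] 1 (σ [ x ]≔ eval σ e)
    runs-assign = runs assign (constant 1 ≤-refl)

    runs-query : ∀ {σ x o e d} → Answer o (eval σ e) d → size (eval σ e) ≤ S → size d ≤ S →
      Runs (x :=query o [ e ]) σ [] 3 (σ [ x ]≔ d)
    runs-query ans l l′ = runs (query ans) (+-mono-≤ 1≤S (+-mono-≤ l (≤-trans l′ (≤-reflexive (sym (+-identityʳ S))))))

    runs-send : ∀ {σ e} → size (eval σ e) ≤ S → Runs (send e) σ (sent (eval σ e) ∷ []) 2 σ
    runs-send l = runs send (+-mono-≤ 1≤S (≤-trans l (≤-reflexive (sym (+-identityʳ S)))))

    runs-receive : ∀ {σ x} d → size d ≤ S → Runs (receive x) σ (got d ∷ []) 2 (σ [ x ]≔ d)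
    runs-receive d l = runs (receive d) (+-mono-≤ 1≤S (≤-trans l (≤-reflexive (sym (+-identityʳ S)))))

    runs-true : ∀ {σ σ′ e c c′ es k a b} → eval σ e ≡ a ∙ b → Runs c σ es k σ′ →
      Runs (if e then c else c′) σ es (suc k) σ′
    runs-true eq (runs e l) = runs (if-true eq e) (+-mono-≤ 1≤S l)

    runs-false : ∀ {σ σ′ e c c′ es k} → eval σ e ≡ nil → Runs c′ σ es k σ′ →
      Runs (if e then c else c′) σ es (suc k) σ′
    runs-false eq (runs e l) = runs (if-false eq e) (+-mono-≤ 1≤S l)

    weaken : ∀ {c σ es k k′ σ′} → k ≤ k′ → Runs c σ es k σ′ → Runs c σ es k′ σ′
    weaken k≤k′ (runs e l) = runs e (≤-trans l (*-monoˡ-≤ S k≤k′))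

    runs-while-false : ∀ {σ e c} → eval σ e ≡ nil → Runs (while e loop c) σ [] 1 σ
    runs-while-false eq = runs (while-false eq) (constant 1 ≤-refl)

    runs-while-true : ∀ {σ σ′ σ″ e c es es′ k k′ a b} → eval σ e ≡ a ∙ b →
      Runs c σ es k σ′ → Runs (while e loop c) σ′ es′ k′ σ″ →
      Runs (while e loop c) σ (es ++ es′) (suc (k + k′)) σ″
    runs-while-true {k = k} {k′} eq (runs e l) (runs e′ l′) = runs (while-true eq e e′)
      (+-mono-≤ 1≤S (≤-trans (+-mono-≤ l l′) (≤-reflexive (sym (*-distribʳ-+ S k k′)))))

    eval-hd : ∀ (σ : Store 10) e {a b} → eval σ e ≡ a ∙ b → eval σ (hd e) ≡ a
    eval-hd σ e eq with eval σ e
    eval-hd σ e refl | _ = refl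

    eval-tl : ∀ (σ : Store 10) e {a b} → eval σ e ≡ a ∙ b → eval σ (tl e) ≡ b
    eval-tl σ e eq with eval σ e
    eval-tl σ e refl | _ = refl

    -- `σ` is a store with holes for the two variables; for a concrete store the four laws about it
    -- hold by `refl`.
    runs-move-onto : ∀ {X : Set} {enc : X → Tree} {x y} (σ : Tree → Tree → Store 10) →
      (∀ s t → lookup (σ s t) x ≡ s) → (∀ s t → lookup (σ s t) y ≡ t) →
      (∀ s s′ t → σ s t [ x ]≔ s′ ≡ σ s′ t) → (∀ s t t′ → σ s t [ y ]≔ t′ ≡ σ s t′) →
      ∀ as bs → Runs (move-onto x y) (σ (encList enc as) (encList enc bs)) [] (suc (length as * 3))
                     (σ nil (encList enc (as ʳ++ bs)))
    runs-move-onto σ x≡ y≡ x≔ y≔ []       bs = runs-while-false (x≡ _ _)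
    runs-move-onto {enc = enc} {x} {y} σ x≡ y≡ x≔ y≔ (a ∷ as) bs = runs-while-true (x≡ _ _)
      (subst (λ τ → Runs _ σ₀ [] 1 τ) push runs-assign then subst (λ τ → Runs _ σ₁ [] 1 τ) pop runs-assign)
      (runs-move-onto σ x≡ y≡ x≔ y≔ as (a ∷ bs))
      where
      σ₀ = σ (enc a ∙ encList enc as) (encList enc bs)
      σ₁ = σ (enc a ∙ encList enc as) (enc a ∙ encList enc bs)
      push : σ₀ [ y ]≔ eval σ₀ (cons (hd (var x)) (var y)) ≡ σ₁
      push = trans (cong (σ₀ [ y ]≔_) (cong₂ _∙_ (eval-hd σ₀ (var x) (x≡ _ _)) (y≡ _ _))) (y≔ _ _ _)
      pop : σ₁ [ x ]≔ eval σ₁ (tl (var x)) ≡ σ (encList enc as) (enc a ∙ encList enc bs)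
      pop = trans (cong (σ₁ [ x ]≔_) (eval-tl σ₁ (var x) (x≡ _ _))) (x≔ _ _ _)

    module _ {n v s Z : Tree} where

      private
        st : (g r y b m rv : Tree) → Store 10
        st g r y b m rv = n ∷ v ∷ s ∷ Z ∷ g ∷ r ∷ y ∷ b ∷ m ∷ rv ∷ []

      runs-walk : ∀ {g b rv} as y →
        Runs walk (st g (encList encArc as) (encNode y) b nil rv) [] (suc (length as * 7))
                  (st g nil (encNode (walked as y)) b nil rv)
      runs-walk []                  y       = runs-while-false refl
      runs-walk ((to m , _) ∷ as)   y       = runs-while-true refl
        (runs-assign then runs-true refl (runs-true refl runs-assign) then runs-assign then runs-assign)
        (runs-walk as (m ∷ y))
      runs-walk ((H , _) ∷ as)      y       = runs-while-true refl
        (weaken (n≤1+n 5) (runs-assign then runs-false refl runs-skip then runs-assign then runs-assign))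
        (runs-walk as y)
      runs-walk ((B , _) ∷ as)      []      = runs-while-true refl
        (runs-assign then runs-true refl (runs-false refl runs-assign) then runs-assign then runs-assign)
        (runs-walk as [])
      runs-walk ((B , _) ∷ as)      (_ ∷ y) = runs-while-true refl
        (runs-assign then runs-true refl (runs-false refl runs-assign) then runs-assign then runs-assign)
        (runs-walk as y)

      runs-differ : ∀ {g r y b rv e e′} f a c →
        let σ = st g r y b (encBool f) rv in
        eval σ e ≡ encBool a → eval σ e′ ≡ encBool c →
        Runs (differ e e′) σ [] 3 (st g r y b (encBool (differs f a c)) rv)
      runs-differ f true  true  eq eq′ = runs-true eq (runs-true eq′ runs-skip)
      runs-differ f true  false eq eq′ = runs-true eq (runs-false eq′ runs-assign)
      runs-differ f false true  eq eq′ = runs-false eq (runs-true eq′ runs-assign)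
      runs-differ f false false eq eq′ = runs-false eq (runs-false eq′ runs-skip)

      runs-compare : ∀ {g y b} f u w →
        Runs compare (st g (encNode w) y b (encBool f) (encNode u)) [] (suc (length u * 10))
                     (st g (encNode (proj₂ (strip f u w))) y b (encBool (proj₁ (strip f u w))) nil)
      runs-compare f []            w  = runs-while-false refl
      runs-compare f (m ∷ u)       [] = runs-while-true refl
        (weaken (m≤m+n 4 5) (runs-false refl runs-assign then runs-assign then runs-assign))
        (runs-compare true u [])
      runs-compare f ((a , b) ∷ u) ((c , d) ∷ w) = runs-while-true refl
        (runs-true refl (runs-differ f a c refl refl then runs-differ (differs f a c) b d refl refl)
          then runs-assign then runs-assign)
        (runs-compare (differs-msg f (a , b) (c , d)) u w)

  -- From one round to the whole program

  module Rounds (N : ℕ) {q} (w : TreeCode q) (decode : ∀ {t} → Vec (Fin q) t → Vec Arc t)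
                (next : Party → Node → Bool) where
    open Sim w decode next
    open Implementation N w decode next
    open Analysis w decode next

    abstract
      -- A list has at most N entries of size at most 19 + 2q, each with one pair node, and a final
      -- nil. The value is hidden to keep multiples of `S` from being unfolded.
      S : ℕ
      S = suc N * (20 + 2 * q)

      1+N≤S : suc N ≤ S
      1+N≤S = m≤m*n (suc N) (20 + 2 * q)

      size-list≤S : ∀ {X : Set} {enc : X → Tree} k → k ≤ 19 + 2 * q → (∀ x → size (enc x) ≤ k) →
        ∀ xs → length xs ≤ N → size (encList enc xs) ≤ S
      size-list≤S k k≤ size≤ xs len≤ = ≤-trans (size-encList size≤ xs)
        (+-mono-≤ (m≤m+n 1 (19 + 2 * q)) (*-mono-≤ len≤ (s≤s k≤)))

      S-def : S ≡ suc N * (20 + 2 * q)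
      S-def = refl

      20+2q≤S : 20 + 2 * q ≤ S
      20+2q≤S = m≤m+n (20 + 2 * q) (N * (20 + 2 * q))

    size-state : ∀ {t} (s : Vec Arc t) → t ≤ N → size (encState s) ≤ S
    size-state s t≤N = size-list≤S 15 (m≤m+n 15 (4 + 2 * q)) size-encArc (toList s)
      (≤-trans (≤-reflexive (length-toList s)) t≤N)

    size-node : ∀ v → length v ≤ N → size (encNode v) ≤ S
    size-node = size-list≤S 7 (m≤m+n 7 (12 + 2 * q)) size-encMsg

    size-label : ∀ (z : Fin q) → size (encLabel z) ≤ suc (2 * q)
    size-label z = ≤-trans (≤-reflexive (size-encℕ (toℕ z))) (s≤s (*-monoʳ-≤ 2 (<⇒≤ (Fin.toℕ<n z))))

    size-label≤S : ∀ (z : Fin q) → size (encLabel z) ≤ S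
    size-label≤S z = ≤-trans (size-label z) (≤-trans (m≤n+m (suc (2 * q)) 19)
      (≤-trans (≤-reflexive (+-suc 19 (2 * q))) 20+2q≤S))

    size-labels : ∀ {t} (Z : Vec (Fin q) t) → t ≤ N → size (encLabels Z) ≤ S
    size-labels Z t≤N = size-list≤S (suc (2 * q)) (m≤n+m (suc (2 * q)) 18) size-label (toList Z)
      (≤-trans (≤-reflexive (length-toList Z)) t≤N)

    size-bit : ∀ b → size (encBool b) ≤ S
    size-bit b = ≤-trans (size-encBool b) (≤-trans (m≤m+n 3 (17 + 2 * q)) 20+2q≤S)

    module _ (i : Party) where
      open Timed (Answer i) S (≤-trans (s≤s z≤n) 1+N≤S) public

      private
        st : (n v s Z g r y b m rv : Tree) → Store 10
        st n v s Z g r y b m rv = n ∷ v ∷ s ∷ Z ∷ g ∷ r ∷ y ∷ b ∷ m ∷ rv ∷ []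

      runs-communicate : ∀ {v t m} (s : Vec Arc (suc t)) (Z : Vec (Fin q) t) z → t < N →
        Runs communicate (st (encℕ (suc m)) v (encState s) (encLabels Z) nil nil nil nil nil nil)
             (sent (encLabel (w s)) ∷ got (encLabel z) ∷ []) 9
             (st (encℕ m) v (encState s) (encLabels (z ∷ Z)) (encLabel z) nil nil nil nil nil)
      runs-communicate s Z z t<N = runs-assign
        then runs-query (label t<N s) (size-state s t<N) (size-label≤S (w s))
        then runs-send (size-label≤S (w s))
        then runs-receive (encLabel z) (size-label≤S z)
        then runs-assign

      runs-infer : ∀ {n v s g t} (Z : Vec (Fin q) (suc t)) → t < N →
        Runs infer (st n v s (encLabels Z) g nil nil nil nil nil) [] (6 + N * 10)
             (st n v s (encLabels Z) nil nil (encNode (pebble (decode Z))) (encBool (proj₂ (head (decode Z)))) nil nil)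
      runs-infer {n} {v} {s} {g} {t} Z t<N = weaken k≤
        (runs-query (decoding t<N Z) (size-labels Z t<N) (size-state d t<N) then rest d)
        where
        d = decode Z
        k : ℕ
        k = 3 + (1 + (suc (length (toList d) * 3) + suc (length (toList d ʳ++ []) * 7)))
        k≤ : k ≤ 6 + N * 10
        k≤ rewrite List.length-reverse (toList d) | length-toList d =
          ≤-trans (≤-reflexive (shuffle (suc t))) (+-monoʳ-≤ 6 (*-monoˡ-≤ 10 t<N))
          where
          shuffle : ∀ t → 3 + (1 + (suc (t * 3) + suc (t * 7))) ≡ 6 + t * 10
          shuffle = solve-∀
        -- `decode Z` is generalised to a variable that can be matched; only then does the head of
        -- its encoding reduce.
        rest : (d : Vec Arc (suc t)) →
          Runs (7F := tl (hd (var 4F)) ⨟ move-onto 4F 5F ⨟ walk)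
            (st n v s (encLabels Z) (encState d) nil nil nil nil nil) []
            (1 + (suc (length (toList d) * 3) + suc (length (toList d ʳ++ []) * 7)))
            (st n v s (encLabels Z) nil nil (encNode (pebble d)) (encBool (proj₂ (head d))) nil nil)
        rest d@((_ , b) ∷ _) = runs-assign
          then runs-move-onto (λ g r → st n v s (encLabels Z) g r nil (encBool b) nil nil)
                 (λ _ _ → refl) (λ _ _ → refl) (λ _ _ _ → refl) (λ _ _ _ → refl) (toList d) []
          then subst (λ y → Runs walk (st n v s (encLabels Z) nil (encList encArc (toList d ʳ++ [])) nil (encBool b) nil nil) []
                                 (suc (length (toList d ʳ++ []) * 7)) (st n v s (encLabels Z) nil nil (encNode y) (encBool b) nil nil))
                 (walked-reverse d []) (runs-walk (toList d ʳ++ []) [])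

      runs-align : ∀ {n s Z b} v y → length v ≤ N → length y ≤ N →
        let r = strip false (reverse v) (reverse y) in
        Runs align (st n (encNode v) s Z nil nil (encNode y) b nil nil) [] (4 + N * 16)
             (st n (encNode v) s Z nil (encNode (proj₂ r)) nil b (encBool (proj₁ r)) nil)
      runs-align {n} {s} {Z} {b} v y v≤N y≤N = weaken k≤ (runs-assign
        then runs-move-onto (λ g rv → st n (encNode v) s Z g nil (encNode y) b nil rv)
               (λ _ _ → refl) (λ _ _ → refl) (λ _ _ _ → refl) (λ _ _ _ → refl) v []
        then runs-move-onto (λ y r → st n (encNode v) s Z nil r y b nil (encNode (reverse v)))
               (λ _ _ → refl) (λ _ _ → refl) (λ _ _ _ → refl) (λ _ _ _ → refl) y []
        then runs-compare false (reverse v) (reverse y))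
        where
        k : ℕ
        k = 1 + (suc (length v * 3) + (suc (length y * 3) + suc (length (reverse v) * 10)))
        k≤ : k ≤ 4 + N * 16
        k≤ rewrite List.length-reverse v = ≤-trans
          (s≤s (+-mono-≤ (s≤s (*-monoˡ-≤ 3 v≤N)) (+-mono-≤ (s≤s (*-monoˡ-≤ 3 y≤N)) (s≤s (*-monoˡ-≤ 10 v≤N)))))
          (≤-reflexive (shuffle N))
          where
          shuffle : ∀ N → 1 + (suc (N * 3) + (suc (N * 3) + suc (N * 10))) ≡ 4 + N * 16
          shuffle = solve-∀

      runs-record : ∀ {n Z g r b t} v m (s : Vec Arc t) → length v ≤ N →
        Runs record-state (st n (encNode v) (encState s) Z g r nil b (encMove m) nil) [] 8
             (st n (encNode v) (encState ((m , next i v) ∷ s)) Z nil nil nil nil nil nil)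
      runs-record v m s v≤N = runs-query (protocol v) (size-node v v≤N) (size-bit (next i v))
        then runs-assign then runs-assign then runs-assign then runs-assign then runs-assign

      eval-pair : ∀ j (σ : Store 10) e f {a b} → eval σ e ≡ encBool a → eval σ f ≡ encBool b →
        eval σ (pair j e f) ≡ encMsg (message j a b)
      eval-pair A σ e f = cong₂ _∙_
      eval-pair B σ e f eq eq′ = cong₂ _∙_ eq′ eq

      runs-advance : ∀ {n Z t} v b (s : Vec Arc t) → length v < N →
        let m = to (message i (next i v) b) in
        Runs (react i ⨟ record-state) (st n (encNode v) (encState s) Z nil nil nil (encBool b) nil nil) [] 15
             (st n (encNode (move m v)) (encState ((m , next i (move m v)) ∷ s)) Z nil nil nil nil nil nil)
      runs-advance {n} {Z} v b s v<N =
        runs-false refl (runs-false refl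
          (runs-query (protocol v) (size-node v (<⇒≤ v<N)) (size-bit (next i v))
            -- `pair i` is stuck while the party is a variable, so its value is supplied by
            -- `eval-pair`.
            then subst (λ x → Runs (8F := cons truth (pair i (var 4F) (var 7F))) σ [] 1 (σ [ 8F ]≔ ((nil ∙ nil) ∙ x)))
                   (eval-pair i σ (var 4F) (var 7F) refl refl) runs-assign
            then runs-assign))
        then runs-record (_ ∷ v) (to _) s v<N
        where
        σ = st n (encNode v) (encState s) Z (encBool (next i v)) nil nil (encBool b) nil nil

      runs-retreat : ∀ {n Z r b t} v (s : Vec Arc t) → length v < N →
        Runs (react i ⨟ record-state)
             (st n (encNode v) (encState s) Z nil r nil b (encBool true) nil) [] 15
             (st n (encNode (parent v)) (encState ((B , next i (parent v)) ∷ s)) Z nil nil nil nil nil nil)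
      runs-retreat []      s v<N = weaken (m≤m+n 10 5) (runs-true refl runs-assign then runs-record [] B s z≤n)
      runs-retreat (_ ∷ v) s v<N = weaken (m≤m+n 10 5)
        (runs-true refl runs-assign then runs-record v B s (≤-trans (n≤1+n _) (<⇒≤ v<N)))

      -- Flag and remainder decide the same cases as `response`: a mismatch means retreat, an empty
      -- remainder means advance, any other remainder means wait. All other combinations contradict
      -- the meaning of prefixes of reversed nodes.
      runs-react : ∀ {n Z t} v y b (s : Vec Arc t) r → length v < N →
        Stripped (reverse v) (reverse y) r →
        let m = response i v y b in
        Runs (react i ⨟ record-state)
             (st n (encNode v) (encState s) Z nil (encNode (proj₂ r)) nil (encBool b) (encBool (proj₁ r)) nil) [] 15
             (st n (encNode (move m v)) (encState ((m , next i (move m v)) ∷ s)) Z nil nil nil nil nil nil)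
      runs-react v y b s _ v<N stripped with v ≟ᴺ y | v ⊑? y | stripped
      ... | yes refl | _ | mismatch none = contradiction (sym (List.++-identityʳ (reverse v))) (none [])
      ... | no _ | yes v⊑y | mismatch none = contradiction (proj₂ (⊑⇒reverse-++ v⊑y)) (none _)
      ... | no _ | no _ | mismatch none = runs-retreat v s v<N
      ... | yes refl | _ | prefix {z} eq rewrite List.++-identityʳ-unique (reverse v) eq = runs-advance v b s v<N
      ... | no v≢y | _ | prefix {[]} eq = contradiction (sym (reverse-++⇒ v y [] eq)) v≢y
      ... | no v≢y | yes _ | prefix {_ ∷ _} eq =
        weaken (m≤m+n 11 4) (runs-false refl (runs-true refl runs-skip) then runs-record v H s (<⇒≤ v<N))
      ... | no v≢y | no v⋢y | prefix {z} eq =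
        contradiction (subst (v ⊑_) (sym (reverse-++⇒ v y z eq)) (reverse z Suffix.++ˢ ⊑-refl)) v⋢y

      snapshot : ℕ → ∀ {t} → Local t → Store 10
      snapshot n L = st (encℕ n) (encNode (position L)) (encState (state L)) (encLabels (received L)) nil nil nil nil nil nil

      length-position : ∀ {t} (Z : Vec (Fin q) t) → length (position (local i Z)) ≤ t
      length-position []      = z≤n
      length-position (z ∷ Z) rewrite position-∷ i z Z =
        ≤-trans (length-move (moveOf i (z ∷ Z)) _) (s≤s (length-position Z))

      runs-round : ∀ {m t} z (Z : Vec (Fin q) t) → t < N →
        Runs (round-cmd i) (snapshot (suc m) (local i Z))
             (sent (encLabel (outgoing (local i Z))) ∷ got (encLabel z) ∷ []) (34 + N * 26)
             (snapshot m (local i (z ∷ Z)))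
      runs-round {m} z Z t<N rewrite local-∷ i z Z | received-local i Z = weaken (≤-reflexive (shuffle N))
        (runs-communicate (state L) Z z t<N
          then runs-infer (z ∷ Z) t<N
          then runs-align v y (≤-trans (length-position Z) (<⇒≤ t<N)) (≤-trans (length-pebble g) t<N)
          then runs-react v y (proj₂ (head g)) (state L) _ (≤-<-trans (length-position Z) t<N)
                 (strip-spec (reverse v) (reverse y)))
        where
        L = local i Z
        g = decode (z ∷ Z)
        v = position L
        y = pebble g
        shuffle : ∀ N → 9 + (6 + N * 10 + (4 + N * 16 + 15)) ≡ 34 + N * 26
        shuffle = solve-∀

      -- `Z` starts with the latest label but the loop with the earliest. The execution of the later
      -- rounds is therefore accumulated in the last argument while the induction peels labels off
      -- `Z`.
      runs-rounds : ∀ {t m es k σ} (Z : Vec (Fin q) t) → t + m ≤ N →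
        Runs (while var 0F loop round-cmd i) (snapshot m (local i Z)) es k σ →
        Runs (while var 0F loop round-cmd i) (snapshot (t + m) (local i [])) (trace i Z ++ es) (t * (35 + N * 26) + k) σ
      runs-rounds []          le rest = rest
      runs-rounds {suc t} {m} {es} {k} {σ} (z ∷ Z) le rest =
        subst (λ n → Runs loop (snapshot n (local i [])) (trace i (z ∷ Z) ++ es) (suc t * (35 + N * 26) + k) σ) (+-suc t m)
          (weaken (≤-reflexive (shuffle (t * (35 + N * 26)) (34 + N * 26) k))
            (subst (λ es → Runs loop (snapshot (t + suc m) (local i [])) es (t * (35 + N * 26) + suc (34 + N * 26 + k)) σ)
              (sym (List.++-assoc (trace i Z) events es))
              (runs-rounds Z (≤-trans (≤-reflexive (+-suc t m)) le)
                (runs-while-true refl (runs-round z Z (≤-trans (m≤m+n (suc t) m) le)) rest))))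
        where
        loop = while var 0F loop round-cmd i
        events = sent (encLabel (outgoing (local i Z))) ∷ got (encLabel z) ∷ []
        shuffle : ∀ a b k → a + suc (b + k) ≡ suc b + a + k
        shuffle = solve-∀

      runs-program : ∀ (Z : Vec (Fin q) N) → ∃[ σ ]
        Runs (Program.body (program i)) (encℕ N ∷ replicate 9 nil) (trace i Z) (7 + N * (35 + N * 26)) σ ×
        head σ ≡ encNode (position (local i Z))
      runs-program Z = _ , weaken (≤-reflexive (shuffle (N * (35 + N * 26))))
        (subst (λ es → Runs (Program.body (program i)) (encℕ N ∷ replicate 9 nil) es (5 + (N * (35 + N * 26) + 1 + 1)) σ)
          events (init then rounds then runs-assign)) , refl
        where
        σ = st (encNode (position L)) (encNode (position L)) (encState (state L)) (encLabels (received L)) nil nil nil nil nil nil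
          where L = local i Z
        shuffle : ∀ x → 5 + (x + 1 + 1) ≡ 7 + x
        shuffle = solve-∀
        events : (trace i Z ++ []) ++ [] ≡ trace i Z
        events = trans (List.++-identityʳ _) (List.++-identityʳ _)
        init : Runs initialise (encℕ N ∷ replicate 9 nil) [] 5 (snapshot N (local i []))
        init = runs-query (protocol []) (size-node [] z≤n) (size-bit (next i [])) then runs-assign then runs-assign
        rounds : Runs (while var 0F loop round-cmd i) (snapshot N (local i [])) (trace i Z ++ []) (N * (35 + N * 26) + 1) (snapshot 0 (local i Z))
        rounds = subst (λ n → Runs (while var 0F loop round-cmd i) (snapshot n (local i [])) (trace i Z ++ []) (N * (35 + N * 26) + 1) (snapshot 0 (local i Z)))
          (+-identityʳ N) (runs-rounds Z (≤-reflexive (+-identityʳ N)) (runs-while-false refl))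

    implements : ∀ {bound} → (7 + N * (35 + N * 26)) * S ≤ bound → ∀ i → Implements (program i) i bound
    implements ≤bound i Z =
      let σ , r , output = runs-program i Z
      in Timed.Runs.steps r , σ , Timed.Runs.exec r , ≤-trans (Timed.Runs.steps≤ r) ≤bound , output

  -- The coefficient left when the step bound is made homogeneous of degree 3 in T + 1: both N and N
  -- + 1 are replaced by 10(T + 1), and the lower-order constants are multiplied by powers of T + 1.
  step-factor : ℕ → ℕ
  step-factor q = (7 + 10 * (35 + 10 * 26)) * (10 * (20 + 2 * q))

  step-bound : ∀ q T → let N = 10 * T in
    (7 + N * (35 + N * 26)) * (suc N * (20 + 2 * q)) ≤ step-factor q * suc T ℕ.^ 3
  step-bound q T = begin
    (7 + N * (35 + N * 26)) * (suc N * c)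
      ≤⟨ *-mono-≤ (+-mono-≤ (m≤m*n 7 (x * x)) (*-mono-≤ N≤ (+-mono-≤ (m≤m*n 35 x) (*-monoˡ-≤ 26 N≤)))) (*-monoˡ-≤ c 1+N≤) ⟩
    (7 * (x * x) + 10 * x * (35 * x + 10 * x * 26)) * (10 * x * c)
      ≡⟨ shuffle x c ⟩
    step-factor q * x ℕ.^ 3  ∎
    where
    open ≤-Reasoning
    N = 10 * T
    c = 20 + 2 * q
    x = suc T
    N≤ : N ≤ 10 * x
    N≤ = *-monoʳ-≤ 10 (n≤1+n T)
    1+N≤ : suc N ≤ 10 * x
    1+N≤ = ≤-trans (s≤s (m≤n+m N 9)) (≤-reflexive (sym (*-suc 10 T)))
    shuffle : ∀ x c → (7 * (x * x) + 10 * x * (35 * x + 10 * x * 26)) * (10 * x * c) ≡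
      (7 + 10 * (35 + 10 * 26)) * (10 * c) * (x * (x * (x * 1)))
    shuffle = solve-∀

  implements : ∀ T {q} (w : TreeCode q) (decode : ∀ {t} → Vec (Fin q) t → Vec Arc t) (next : Party → Node → Bool) →
    ∀ i → Implementation.Implements (10 * T) w decode next (program i) i (step-factor q * suc T ℕ.^ 3)
  implements T {q} w decode next = Rounds.implements N w decode next (≤-trans
    (≤-reflexive (cong ((7 + N * (35 + N * 26)) *_) (Rounds.S-def N w decode next))) (step-bound q T))
    where N = 10 * T

open Programs

theorem5p1 : ∀ {c ℓ₁ ℓ₂} (ℛ : Reals c ℓ₁ ℓ₂) →
    let open Reals ℛ
        open Probability ℛ in
    (α : Carrier) (0<α : 0# < α) → α < 1# →
    ∃[ C ] Σ Carrier λ κ →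
      0 ℕ.< C ×
      0# < κ ×
      ((q : ℕ) → Σ (Party → Program) λ P → ∃[ a ] ∃[ d ]
       ((T : ℕ) (π : Protocol) (x : ∀ i → Protocol.Input π i) →
        (w : TreeCode q) (decode : ∀ {t} → Vec (Fin q) t → Vec Arc t) →
        let N    = C ℕ.* T
            next = nextBit T π x
            open Sim w decode next
            open Implementation N w decode next in
        Potent ℛ N (recip (0<fromℕ 9)) α w →
        IsDecoder N w decode →
        (∀ i → Implements (P i) i (a ℕ.* suc T ℕ.^ d)) ×
        ((p : Carrier) (K : Party → Channel q) →
         p < exp₂ (- (fromℕ 42 * recip 0<α)) →
         (∀ i → IsChannel (K i)) →
         (∀ i → ErrorAtMost p (K i)) →
         1# - exp₂ (- (κ * fromℕ T)) ≤ Pr (success? T) (run ℛ K N))))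
theorem5p1 ℛ α 0<α α<1 =
  -- The rate κ = 1 is the gap between the mean weight 2 ^ T and the threshold 4 ^ T.
  10 , 1# , s≤s z≤n , 0<1 , λ q →
  program , step-factor q , 3 , λ T π x w decode potent dec →
  implements T w decode (nextBit T π x) ,
  Simulation.success-probability ℛ w decode (nextBit T π x) 0<α α<1 T potent dec
  where open Reals ℛ
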